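{- There are no $B5$-collinear integers. That is, no positive integer $k$ is $B5$-collinear.
   Context: A lattice triangle is a (non-degenerate) triangle in the plane whose three vertices lie in $\mathbb{Z}^2$. Its boundary points are the points of $\mathbb{Z}^2$ on its boundary (vertices included), and its interior points are the points of $\mathbb{Z}^2$ in its topological interior. For a positive integer $n$, a positive integer $k$ is called $Bn$-collinear if (i) there exists at least one lattice triangle with exactly $n$ boundary points and exactly $k$ interior points, and (ii) for every lattice triangle with exactly $n$ boundary points and exactly $k$ interior points, the $k$ interior points all lie on a common line. -}

module Defs where

open import Data.Integer using (ℤ)
open import Data.List using (List; []; _∷_; length)
open import Data.List.Membership.Propositional using (_∈_)
open import Data.List.Relation.Unary.Unique.Propositional using (Unique)
open import Data.Nat using (ℕ)
open import Data.Product using (_×_; _,_; ∃; ∃-syntax)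
open import Data.Rational
  using (ℚ; 0ℚ; 1ℚ; _+_; _-_; _*_; _/_; _≤_; _<_; ∣_∣)
open import Data.Sum using (_⊎_)
open import Function.Bundles using (_⇔_)
open import Level using (0ℓ)
open import Relation.Binary.PropositionalEquality using (_≡_)
open import Relation.Nullary using (¬_)
open import Relation.Unary using (Pred)

-- The ambient plane is ℚ × ℚ.  For the lattice points of a triangle or
-- segment with lattice vertices this agrees with the real plane: convex
-- coefficients of lattice points can be taken rational, a closed set that
-- contains all rational points of an open square contains the square, and
-- a line through two distinct lattice points has rational coefficients.

Plane : Set
Plane = ℚ × ℚ

Lattice : Set
Lattice = ℤ × ℤ

ι : Lattice → Plane
ι (x , y) = x / 1 , y / 1

infixl 6 _⊕_
infixl 7 _·_

_⊕_ : Plane → Plane → Plane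
(x , y) ⊕ (x′ , y′) = x + x′ , y + y′

_·_ : ℚ → Plane → Plane
t · (x , y) = t * x , t * y

OnLine : (a b c : ℚ) → Pred Plane 0ℓ
OnLine a b c (x , y) = a * x + b * y ≡ c

Collinear : Pred Lattice 0ℓ → Set
Collinear S =
  ∃[ a ] ∃[ b ] ∃[ c ]
    ¬ (a ≡ 0ℚ × b ≡ 0ℚ) × (∀ p → S p → OnLine a b c (ι p))

record LatticeTriangle : Set where
  field
    A B C         : Lattice
    nondegenerate : ¬ Collinear (_∈ A ∷ B ∷ C ∷ [])

Segment : (u v : Plane) → Pred Plane 0ℓ
Segment u v p =
  ∃[ t ] 0ℚ ≤ t × t ≤ 1ℚ × p ≡ (1ℚ - t) · u ⊕ t · v

-- Open squares (balls for the sup norm) as basic neighbourhoods.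
TopologicalInterior : Pred Plane 0ℓ → Pred Plane 0ℓ
TopologicalInterior S (x , y) =
  ∃[ ε ] 0ℚ < ε ×
    (∀ x′ y′ → ∣ x′ - x ∣ < ε → ∣ y′ - y ∣ < ε → S (x′ , y′))

module _ (T : LatticeTriangle) where
  open LatticeTriangle T

  Region : Pred Plane 0ℓ
  Region p =
    ∃[ α ] ∃[ β ] ∃[ γ ]
      0ℚ ≤ α × 0ℚ ≤ β × 0ℚ ≤ γ × α + β + γ ≡ 1ℚ ×
      p ≡ α · ι A ⊕ β · ι B ⊕ γ · ι C

  BoundaryPoint : Pred Lattice 0ℓ
  BoundaryPoint p =
    Segment (ι A) (ι B) (ι p) ⊎
    Segment (ι B) (ι C) (ι p) ⊎
    Segment (ι C) (ι A) (ι p)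

  InteriorPoint : Pred Lattice 0ℓ
  InteriorPoint p = TopologicalInterior Region (ι p)

HasExactly : ℕ → Pred Lattice 0ℓ → Set
HasExactly n S =
  ∃[ ps ] Unique ps × length ps ≡ n × (∀ p → p ∈ ps ⇔ S p)

HasCounts : (n k : ℕ) → LatticeTriangle → Set
HasCounts n k T =
  HasExactly n (BoundaryPoint T) × HasExactly k (InteriorPoint T)

-- Meaningful for positive n and k only; positivity is left to statements
-- about this predicate.
BCollinear : (n k : ℕ) → Set
BCollinear n k =
  ∃ (HasCounts n k) ×
  (∀ T → HasCounts n k T → Collinear (InteriorPoint T))

{-# OPTIONS --safe #-}
module Submission where

-- If two edges have even lattice length then so has the third; therefore five
-- boundary points force edges of lattice lengths 3, 1, 1.
-- In a lattice basis along the long edge the triangle has vertices (0 , 0),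
-- (3 , 0), (x , h), where x and x − 3 are prime to h; hence h = 2m + 1.  In
-- the parallelogram spanned by the triangle every row strictly between the
-- horizontal sides holds exactly 3 points, none of them on the hypotenuse
-- through (3 , 0) and (x , h).  Point reflection exchanges the triangle with
-- the rest of the parallelogram and row y with row h − y, so it folds the 3m
-- points of the rows 1, …, m onto the interior points of the triangle, and
-- k = 3m.  The triangle (0 , 0), (3 , 0), (1 , 2m + 1) has the same counts,
-- but its interior points (1 , 1), (2 , 1), (1 , 2) are not collinear.

open import Defs

open import Algebra.Bundles using (module AbelianGroup)
import Algebra.Properties.Group
open import Data.Empty using (⊥; ⊥-elim)
open import Data.Fin as Fin using (Fin; toℕ; fromℕ<)
import Data.Fin.Properties as Fin
import Data.Integer
open import Data.Integer as ℤ using (ℤ; +_; -[1+_]; 0ℤ; 1ℤ; +≤+; +<+)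
import Data.Integer.DivMod as ℤ
import Data.Integer.Properties as ℤ
open import Data.Integer.Tactic.RingSolver using () renaming (ring to ℤ-ring)
open import Data.List using (List; []; _∷_; _++_; length; map; allFin; cartesianProduct)
open import Data.List.Membership.Propositional using (_∈_)
open import Data.List.Membership.Propositional.Properties
  using (∈-map⁺; ∈-map⁻; ∈-++⁺ˡ; ∈-++⁺ʳ; ∈-++⁻; ∈-allFin; ∈-cartesianProduct⁺)
open import Data.List.Membership.Propositional.Properties.WithK using (unique∧set⇒bag)
open import Data.List.Properties using (length-map; length-++; length-tabulate)
open import Data.List.Relation.Binary.BagAndSetEquality using (∼bag⇒↭)
open import Data.List.Relation.Binary.Permutation.Propositional.Properties using (↭-length)
open import Data.List.Relation.Unary.Any using (here; there)
open import Data.List.Relation.Unary.Unique.Propositional using (Unique)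
import Data.List.Relation.Unary.Unique.Propositional.Properties as Unique
open import Data.Maybe.Base using (just; nothing)
open import Data.Nat as ℕ using (ℕ; zero; suc; s≤s; z≤n)
open import Data.Nat.Divisibility renaming (_∣_ to _∣ℕ_) using (divides)
open import Data.Nat.GCD using (module GCD; module Bézout)
import Data.Nat.Properties as ℕ
open import Data.Product using (_×_; _,_; ∃-syntax; proj₁; proj₂)
open import Data.Product.Properties using (≡-dec)
import Data.Rational
open import Data.Rational as ℚ using (ℚ; 0ℚ; 1ℚ; _/_)
import Data.Rational.Properties as ℚ
import Data.Rational.Unnormalised as ℚᵘ
import Data.Rational.Unnormalised.Properties as ℚᵘ
open import Data.Sum using (_⊎_; inj₁; inj₂)
open import Function.Bundles using (_⇔_; mk⇔; module Equivalence)
import Function.Properties.Equivalence as ⇔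
open import Level using (0ℓ)
open import Relation.Binary.Definitions using (tri<; tri≈; tri>)
open import Relation.Binary.PropositionalEquality hiding (J; [_])
open import Relation.Nullary using (¬_; Dec; yes; no; contradiction)
open import Tactic.RingSolver using (solve-∀)
import Tactic.RingSolver.Core.AlmostCommutativeRing as ACR

-- By Pick's formula 3h, twice the area, equals 2k + 3; this explains the value of k, but
-- `HasExactly` asks for a list, so the count is a bijection with `Fin m × Fin 3`. It is set up for
-- arbitrary x and m and serves both the given triangle and the example. Halving the parallelogram
-- by rows rather than along the hypotenuse keeps the enumeration regular: whole rows have 3 points
-- each, while the rows of the triangle itself vary in length. As h is odd, no row is its own mirror
-- image. The interior is defined topologically and a triangle may have either orientation, hence
-- the passage through sign conditions on products of two determinants. Positivity of k matters
-- through m ≥ 1: only then does the example have an interior row 2.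

ℚ-ring : ACR.AlmostCommutativeRing 0ℓ 0ℓ
ℚ-ring = ACR.fromCommutativeRing ℚ.+-*-commutativeRing is0?
  where
  is0? : ∀ x → _
  is0? x with 0ℚ ℚ.≟ x
  ... | yes p = just p
  ... | no _ = nothing

-- The embedding of the integers into the rationals

⟦_⟧ : ℤ → ℚ
⟦ i ⟧ = i / 1

-- Normalisation by a gcd blocks direct computation with `i / 1`. It is equivalent to the
-- unnormalised fraction over 1, for which the laws below are integer identities.
toℚᵘ-⟦⟧ : ∀ i → ℚ.toℚᵘ ⟦ i ⟧ ℚᵘ.≃ ℚᵘ.mkℚᵘ i 0
toℚᵘ-⟦⟧ i = ℚ.toℚᵘ-fromℚᵘ (ℚᵘ.mkℚᵘ i 0)

⟦⟧-+ : ∀ i j → ⟦ i ℤ.+ j ⟧ ≡ ⟦ i ⟧ ℚ.+ ⟦ j ⟧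
⟦⟧-+ i j = ℚ.toℚᵘ-injective (ℚᵘ.≃-trans (toℚᵘ-⟦⟧ (i ℤ.+ j)) (ℚᵘ.≃-sym
  (ℚᵘ.≃-trans (ℚ.toℚᵘ-homo-+ ⟦ i ⟧ ⟦ j ⟧)
  (ℚᵘ.≃-trans (ℚᵘ.+-cong (toℚᵘ-⟦⟧ i) (toℚᵘ-⟦⟧ j)) (ℚᵘ.*≡* (eq i j))))))
  where
  eq : ∀ i j → (i ℤ.* + 1 ℤ.+ j ℤ.* + 1) ℤ.* + 1 ≡ (i ℤ.+ j) ℤ.* + 1
  eq = solve-∀ ℤ-ring

⟦⟧-* : ∀ i j → ⟦ i ℤ.* j ⟧ ≡ ⟦ i ⟧ ℚ.* ⟦ j ⟧
⟦⟧-* i j = ℚ.toℚᵘ-injective (ℚᵘ.≃-trans (toℚᵘ-⟦⟧ (i ℤ.* j)) (ℚᵘ.≃-sym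
  (ℚᵘ.≃-trans (ℚ.toℚᵘ-homo-* ⟦ i ⟧ ⟦ j ⟧)
  (ℚᵘ.≃-trans (ℚᵘ.*-cong (toℚᵘ-⟦⟧ i) (toℚᵘ-⟦⟧ j)) (ℚᵘ.*≡* refl)))))

⟦⟧-neg : ∀ i → ⟦ ℤ.- i ⟧ ≡ ℚ.- ⟦ i ⟧
⟦⟧-neg i = ℚ.toℚᵘ-injective (ℚᵘ.≃-trans (toℚᵘ-⟦⟧ (ℤ.- i)) (ℚᵘ.≃-sym
  (ℚᵘ.≃-trans (ℚ.toℚᵘ-homo‿- ⟦ i ⟧) (ℚᵘ.-‿cong (toℚᵘ-⟦⟧ i)))))

⟦⟧-- : ∀ i j → ⟦ i ℤ.- j ⟧ ≡ ⟦ i ⟧ ℚ.- ⟦ j ⟧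
⟦⟧-- i j = trans (⟦⟧-+ i (ℤ.- j)) (cong (⟦ i ⟧ ℚ.+_) (⟦⟧-neg j))

⟦⟧-mono-≤ : ∀ {i j} → i ℤ.≤ j → ⟦ i ⟧ ℚ.≤ ⟦ j ⟧
⟦⟧-mono-≤ {i} {j} p = ℚ.toℚᵘ-cancel-≤
  (ℚᵘ.≤-respˡ-≃ (ℚᵘ.≃-sym (toℚᵘ-⟦⟧ i)) (ℚᵘ.≤-respʳ-≃ (ℚᵘ.≃-sym (toℚᵘ-⟦⟧ j))
    (ℚᵘ.*≤* (ℤ.*-monoʳ-≤-nonNeg (+ 1) p))))

⟦⟧-cancel-≤ : ∀ {i j} → ⟦ i ⟧ ℚ.≤ ⟦ j ⟧ → i ℤ.≤ j
⟦⟧-cancel-≤ {i} {j} p = ℤ.*-cancelʳ-≤-pos i j (+ 1) (ℚᵘ.drop-*≤*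
  (ℚᵘ.≤-respˡ-≃ (toℚᵘ-⟦⟧ i) (ℚᵘ.≤-respʳ-≃ (toℚᵘ-⟦⟧ j) (ℚ.toℚᵘ-mono-≤ p))))

⟦⟧-injective : ∀ {i j} → ⟦ i ⟧ ≡ ⟦ j ⟧ → i ≡ j
⟦⟧-injective p = ℤ.≤-antisym (⟦⟧-cancel-≤ (ℚ.≤-reflexive p)) (⟦⟧-cancel-≤ (ℚ.≤-reflexive (sym p)))

⟦⟧-mono-< : ∀ {i j} → i ℤ.< j → ⟦ i ⟧ ℚ.< ⟦ j ⟧
⟦⟧-mono-< p = ℚ.≰⇒> λ q → ℤ.<⇒≱ p (⟦⟧-cancel-≤ q)

⟦⟧-cancel-< : ∀ {i j} → ⟦ i ⟧ ℚ.< ⟦ j ⟧ → i ℤ.< j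
⟦⟧-cancel-< p = ℤ.≰⇒> λ q → ℚ.<-irrefl refl (ℚ.<-≤-trans p (⟦⟧-mono-≤ q))

-- Estimates in small squares

module _ where
  open import Data.Rational using (_+_; _*_; _-_; -_; ∣_∣; _<_; _≤_; 1/_; Positive; NonZero; positive; nonNegative)
  open ℚ.≤-Reasoning

  p≤∣p∣ : ∀ p → p ≤ ∣ p ∣
  p≤∣p∣ p with ℚ.≤-total 0ℚ p
  ... | inj₁ 0≤p = ℚ.≤-reflexive (sym (ℚ.0≤p⇒∣p∣≡p 0≤p))
  ... | inj₂ p≤0 = ℚ.≤-trans p≤0 (ℚ.0≤∣p∣ p)

  -- The summand 1 makes the value positive, so that it can be divided by, and strictly larger than
  -- both absolute values.
  norm : ℚ → ℚ → ℚ
  norm u w = 1ℚ + ∣ u ∣ + ∣ w ∣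

  module _ (u w : ℚ) where
    ∣u∣<norm : ∣ u ∣ < norm u w
    ∣u∣<norm = begin-strict
      ∣ u ∣               ≡⟨ sym (ℚ.+-identityˡ ∣ u ∣) ⟩
      0ℚ + ∣ u ∣          <⟨ ℚ.+-monoˡ-< ∣ u ∣ (ℚ.positive⁻¹ 1ℚ) ⟩
      1ℚ + ∣ u ∣          ≡⟨ sym (ℚ.+-identityʳ _) ⟩
      1ℚ + ∣ u ∣ + 0ℚ     ≤⟨ ℚ.+-monoʳ-≤ (1ℚ + ∣ u ∣) (ℚ.0≤∣p∣ w) ⟩
      norm u w ∎

    ∣w∣<norm : ∣ w ∣ < norm u w
    ∣w∣<norm = begin-strict
      ∣ w ∣               ≡⟨ sym (ℚ.+-identityˡ ∣ w ∣) ⟩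
      0ℚ + ∣ w ∣          <⟨ ℚ.+-monoˡ-< ∣ w ∣ (ℚ.<-≤-trans (ℚ.positive⁻¹ 1ℚ)
                              (ℚ.≤-trans (ℚ.≤-reflexive (sym (ℚ.+-identityʳ 1ℚ))) (ℚ.+-monoʳ-≤ 1ℚ (ℚ.0≤∣p∣ u)))) ⟩
      norm u w ∎

    ∣u∣+∣w∣≤norm : ∣ u ∣ + ∣ w ∣ ≤ norm u w
    ∣u∣+∣w∣≤norm = ℚ.+-monoˡ-≤ ∣ w ∣ (begin
      ∣ u ∣               ≡⟨ sym (ℚ.+-identityˡ ∣ u ∣) ⟩
      0ℚ + ∣ u ∣          ≤⟨ ℚ.+-monoˡ-≤ ∣ u ∣ (ℚ.nonNegative⁻¹ 1ℚ) ⟩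
      1ℚ + ∣ u ∣ ∎)

  scale : ∀ ε u w → 0ℚ < ε → ∃[ δ ] 0ℚ < δ × δ * norm u w ≡ ε
  scale ε u w 0<ε = ε * 1/ N , ℚ.positive⁻¹ (ε * 1/ N) , trans (ℚ.*-assoc ε (1/ N) N)
      (trans (cong (ε *_) (ℚ.*-inverseˡ N)) (ℚ.*-identityʳ ε))
    where
    N = norm u w
    instance
      N-pos : Positive N
      N-pos = ℚ.pos+nonNeg⇒pos (1ℚ + ∣ u ∣) {{ℚ.pos+nonNeg⇒pos 1ℚ ∣ u ∣ {{ℚ.∣-∣-nonNeg u}}}}
                ∣ w ∣ {{ℚ.∣-∣-nonNeg w}}
      N-nonZero : NonZero N
      N-nonZero = ℚ.pos⇒nonZero N
      ε/N-pos : Positive (ε * 1/ N)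
      ε/N-pos = ℚ.pos*pos⇒pos ε {{positive 0<ε}} (1/ N) {{ℚ.1/pos⇒pos N}}

  shrink : ∀ ε u w → 0ℚ < ε → ∃[ δ ] 0ℚ < δ × ∣ δ * u ∣ < ε × ∣ δ * w ∣ < ε
  shrink ε u w 0<ε = δ , 0<δ , bound u (∣u∣<norm u w) , bound w (∣w∣<norm u w)
    where
    s = scale ε u w 0<ε
    δ = proj₁ s
    0<δ = proj₁ (proj₂ s)
    bound : ∀ z → ∣ z ∣ < norm u w → ∣ δ * z ∣ < ε
    bound z z<norm = begin-strict
      ∣ δ * z ∣     ≡⟨ ℚ.∣p*q∣≡∣p∣*∣q∣ δ z ⟩
      ∣ δ ∣ * ∣ z ∣ ≡⟨ cong (_* ∣ z ∣) (ℚ.0≤p⇒∣p∣≡p (ℚ.<⇒≤ 0<δ)) ⟩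
      δ * ∣ z ∣     <⟨ ℚ.*-monoʳ-<-pos δ {{positive 0<δ}} z<norm ⟩
      δ * norm u w     ≡⟨ proj₂ (proj₂ s) ⟩
      ε             ∎

  -- An affine function with value `v` at the centre and gradient `(k , l)` changes by at most
  -- `ε * norm k l` on the square, and `ε` is chosen to make this bound `v`.
  affine-nonneg-near : ∀ v k l → 0ℚ < v →
    ∃[ ε ] 0ℚ < ε × (∀ dx dy → ∣ dx ∣ < ε → ∣ dy ∣ < ε → 0ℚ ≤ v + (k * dx + l * dy))
  affine-nonneg-near v k l 0<v = ε , 0<ε , nonneg
    where
    s = scale v k l 0<v
    ε = proj₁ s
    0<ε = proj₁ (proj₂ s)
    term : ∀ k d → ∣ d ∣ < ε → ∣ k * d ∣ ≤ ε * ∣ k ∣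
    term k d d<ε = begin
      ∣ k * d ∣     ≡⟨ ℚ.∣p*q∣≡∣p∣*∣q∣ k d ⟩
      ∣ k ∣ * ∣ d ∣ ≤⟨ ℚ.*-monoˡ-≤-nonNeg ∣ k ∣ {{ℚ.∣-∣-nonNeg k}} (ℚ.<⇒≤ d<ε) ⟩
      ∣ k ∣ * ε     ≡⟨ ℚ.*-comm ∣ k ∣ ε ⟩
      ε * ∣ k ∣     ∎
    nonneg : ∀ dx dy → ∣ dx ∣ < ε → ∣ dy ∣ < ε → 0ℚ ≤ v + (k * dx + l * dy)
    nonneg dx dy dx<ε dy<ε = begin
      0ℚ     ≡⟨ sym (ℚ.+-inverseˡ t) ⟩
      - t + t  ≤⟨ ℚ.+-monoˡ-≤ t -t≤v ⟩
      v + t  ∎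
      where
      t = k * dx + l * dy
      -t≤v : - t ≤ v
      -t≤v = begin
        - t                     ≤⟨ p≤∣p∣ (- t) ⟩
        ∣ - t ∣                 ≡⟨ ℚ.∣-p∣≡∣p∣ t ⟩
        ∣ t ∣                   ≤⟨ ℚ.∣p+q∣≤∣p∣+∣q∣ (k * dx) (l * dy) ⟩
        ∣ k * dx ∣ + ∣ l * dy ∣ ≤⟨ ℚ.+-mono-≤ (term k dx dx<ε) (term l dy dy<ε) ⟩
        ε * ∣ k ∣ + ε * ∣ l ∣   ≡⟨ sym (ℚ.*-distribˡ-+ ε ∣ k ∣ ∣ l ∣) ⟩
        ε * (∣ k ∣ + ∣ l ∣)     ≤⟨ ℚ.*-monoˡ-≤-nonNeg ε {{nonNegative (ℚ.<⇒≤ 0<ε)}} (∣u∣+∣w∣≤norm k l) ⟩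
        ε * norm k l               ≡⟨ proj₂ (proj₂ s) ⟩
        v                       ∎

-- Barycentric description of the interior

-- The determinant of `Q - P` and `R - P`, twice the signed area of the triangle; `area` below is
-- therefore doubled as well.
orient : Lattice → Lattice → Lattice → ℤ
orient (px , py) (qx , qy) (rx , ry) = (qx - px) * (ry - py) - (qy - py) * (rx - px)
  where open Data.Integer using (_*_; _-_)

-- Arguments are carried out for one vertex or one arrangement of the edges; cyclic renaming
-- supplies the others.
rotate : LatticeTriangle → LatticeTriangle
rotate T = record
  { A = B ; B = C ; C = A
  ; nondegenerate = λ (a , b , c , ab≢0 , on) → nondegenerate
      (a , b , c , ab≢0 , λ where
        p (here refl) → on p (there (there (here refl)))
        p (there (here refl)) → on p (here refl)
        p (there (there (here refl))) → on p (there (here refl)))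
  }
  where open LatticeTriangle T

module _ where
  open import Data.Rational using (_+_; _*_; _-_; -_; ∣_∣; _<_; _≤_; _⊓_; 1/_; Positive; NonZero; positive; nonNegative; ≢-nonZero)
  open ℚ.≤-Reasoning

  orientℚ : Plane → Plane → Plane → ℚ
  orientℚ (px , py) (qx , qy) (rx , ry) = (qx - px) * (ry - py) - (qy - py) * (rx - px)

  ⟦orient⟧ : ∀ P Q R → ⟦ orient P Q R ⟧ ≡ orientℚ (ι P) (ι Q) (ι R)
  ⟦orient⟧ (px , py) (qx , qy) (rx , ry) =
    trans (⟦⟧-- ((qx ℤ.- px) ℤ.* (ry ℤ.- py)) ((qy ℤ.- py) ℤ.* (rx ℤ.- px)))
      (cong₂ _-_ (prod qx px ry py) (prod qy py rx px))
    where
    prod : ∀ a b c d → ⟦ (a ℤ.- b) ℤ.* (c ℤ.- d) ⟧ ≡ (⟦ a ⟧ - ⟦ b ⟧) * (⟦ c ⟧ - ⟦ d ⟧)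
    prod a b c d = trans (⟦⟧-* (a ℤ.- b) (c ℤ.- d)) (cong₂ _*_ (⟦⟧-- a b) (⟦⟧-- c d))

  -- A barycentric coordinate is a ratio of two areas over the same side. Once the constant term
  -- carries a factor 1, replaced by `α + β + γ`, the claim is a polynomial identity.
  orientℚ-combination : ∀ A B C α β γ → α + β + γ ≡ 1ℚ →
    orientℚ (α · A ⊕ β · B ⊕ γ · C) B C ≡ α * orientℚ A B C
  orientℚ-combination (ax , ay) (bx , by) (cx , cy) α β γ α+β+γ≡1 = begin-equality
    orientℚ (px , py) (bx , by) (cx , cy)
      ≡⟨ linear px py bx by cx cy ⟩
    1ℚ * (bx * cy - by * cx) + px * (by - cy) + py * (cx - bx)
      ≡⟨ cong (λ s → s * (bx * cy - by * cx) + px * (by - cy) + py * (cx - bx)) (sym α+β+γ≡1) ⟩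
    (α + β + γ) * (bx * cy - by * cx) + px * (by - cy) + py * (cx - bx)
      ≡⟨ combine ax ay bx by cx cy α β γ ⟩
    α * orientℚ (ax , ay) (bx , by) (cx , cy) ∎
    where
    px = α * ax + β * bx + γ * cx
    py = α * ay + β * by + γ * cy
    linear : ∀ px py bx by cx cy → (bx - px) * (cy - py) - (by - py) * (cx - px)
      ≡ 1ℚ * (bx * cy - by * cx) + px * (by - cy) + py * (cx - bx)
    linear = solve-∀ ℚ-ring
    combine : ∀ ax ay bx by cx cy α β γ →
      (α + β + γ) * (bx * cy - by * cx) + (α * ax + β * bx + γ * cx) * (by - cy)
        + (α * ay + β * by + γ * cy) * (cx - bx)
      ≡ α * ((bx - ax) * (cy - ay) - (by - ay) * (cx - ax))
    combine = solve-∀ ℚ-ring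

  p*q≡0⇒p≡0 : ∀ p q → q ≢ 0ℚ → p * q ≡ 0ℚ → p ≡ 0ℚ
  p*q≡0⇒p≡0 p q q≢0 pq≡0 = begin-equality
    p              ≡⟨ sym (ℚ.*-identityʳ p) ⟩
    p * 1ℚ         ≡⟨ cong (p *_) (sym (ℚ.*-inverseʳ q)) ⟩
    p * (q * 1/ q) ≡⟨ sym (ℚ.*-assoc p q (1/ q)) ⟩
    p * q * 1/ q   ≡⟨ cong (_* 1/ q) pq≡0 ⟩
    0ℚ * 1/ q      ≡⟨ ℚ.*-zeroˡ (1/ q) ⟩
    0ℚ             ∎
    where
    instance
      q-nonZero : NonZero q
      q-nonZero = ≢-nonZero q≢0

  p-q≡0⇒p≡q : ∀ p q → p - q ≡ 0ℚ → p ≡ q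
  p-q≡0⇒p≡q p q p-q≡0 = trans (eq p q) (trans (cong (_+ q) p-q≡0) (ℚ.+-identityˡ q))
    where
    eq : ∀ p q → p ≡ p - q + q
    eq = solve-∀ ℚ-ring

  line-through : ∀ P Q → P ≢ Q →
    ∃[ a ] ∃[ b ] ∃[ c ] ¬ (a ≡ 0ℚ × b ≡ 0ℚ) × (∀ R → orient P Q R ≡ 0ℤ → OnLine a b c (ι R))
  line-through P@(px , py) Q@(qx , qy) P≢Q =
    a , b , a * ⟦ px ⟧ + b * ⟦ py ⟧ , nonzero , on
    where
    a = ⟦ py ⟧ - ⟦ qy ⟧
    b = ⟦ qx ⟧ - ⟦ px ⟧
    c = a * ⟦ px ⟧ + b * ⟦ py ⟧
    nonzero : ¬ (a ≡ 0ℚ × b ≡ 0ℚ)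
    nonzero (y≡ , x≡) = P≢Q (cong₂ _,_
      (sym (⟦⟧-injective (p-q≡0⇒p≡q ⟦ qx ⟧ ⟦ px ⟧ x≡)))
      (⟦⟧-injective (p-q≡0⇒p≡q ⟦ py ⟧ ⟦ qy ⟧ y≡)))
    eq : ∀ px py qx qy rx ry → (py - qy) * rx + (qx - px) * ry
      ≡ ((qx - px) * (ry - py) - (qy - py) * (rx - px)) + ((py - qy) * px + (qx - px) * py)
    eq = solve-∀ ℚ-ring
    on : ∀ R → orient P Q R ≡ 0ℤ → OnLine a b c (ι R)
    on R@(rx , ry) PQR≡0 = begin-equality
      a * ⟦ rx ⟧ + b * ⟦ ry ⟧
        ≡⟨ eq ⟦ px ⟧ ⟦ py ⟧ ⟦ qx ⟧ ⟦ qy ⟧ ⟦ rx ⟧ ⟦ ry ⟧ ⟩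
      orientℚ (ι P) (ι Q) (ι R) + c ≡⟨ cong (_+ c) (trans (sym (⟦orient⟧ P Q R)) (cong ⟦_⟧ PQR≡0)) ⟩
      0ℚ + c                        ≡⟨ ℚ.+-identityˡ c ⟩
      c                             ∎

  -- Differences of the three line equations form a homogeneous linear system for `(a , b)` whose
  -- determinant is `D`; Cramer's rule gives `a * D ≡ 0` and `b * D ≡ 0`.
  orient≢0⇒¬Collinear : ∀ {S : Lattice → Set} {P Q R} → S P → S Q → S R →
    orient P Q R ≢ 0ℤ → ¬ Collinear S
  orient≢0⇒¬Collinear {S} {P@(px′ , py′)} {Q@(qx′ , qy′)} {R@(rx′ , ry′)} SP SQ SR D≢0 (a , b , c , ab≢0 , on) =
    ab≢0 (p*q≡0⇒p≡0 a D D≢0ℚ (begin-equality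
            a * D ≡⟨ eqa a b px py qx qy rx ry ⟩
            (ry - py) * (on′ Q - on′ P) - (qy - py) * (on′ R - on′ P) ≡⟨ cancel (ry - py) (qy - py) ⟩
            0ℚ ∎)
         , p*q≡0⇒p≡0 b D D≢0ℚ (begin-equality
            b * D ≡⟨ eqb a b px py qx qy rx ry ⟩
            (qx - px) * (on′ R - on′ P) - (rx - px) * (on′ Q - on′ P) ≡⟨ cancel′ (qx - px) (rx - px) ⟩
            0ℚ ∎))
    where
    px = ⟦ px′ ⟧ ; py = ⟦ py′ ⟧ ; qx = ⟦ qx′ ⟧ ; qy = ⟦ qy′ ⟧ ; rx = ⟦ rx′ ⟧ ; ry = ⟦ ry′ ⟧
    D = orientℚ (ι P) (ι Q) (ι R)
    D≢0ℚ : D ≢ 0ℚ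
    D≢0ℚ D≡0 = D≢0 (⟦⟧-injective (trans (⟦orient⟧ P Q R) D≡0))
    on′ : Lattice → ℚ
    on′ (x , y) = a * ⟦ x ⟧ + b * ⟦ y ⟧
    eqa : ∀ a b px py qx qy rx ry →
      a * ((qx - px) * (ry - py) - (qy - py) * (rx - px))
      ≡ (ry - py) * ((a * qx + b * qy) - (a * px + b * py)) - (qy - py) * ((a * rx + b * ry) - (a * px + b * py))
    eqa = solve-∀ ℚ-ring
    eqb : ∀ a b px py qx qy rx ry →
      b * ((qx - px) * (ry - py) - (qy - py) * (rx - px))
      ≡ (qx - px) * ((a * rx + b * ry) - (a * px + b * py)) - (rx - px) * ((a * qx + b * qy) - (a * px + b * py))
    eqb = solve-∀ ℚ-ring
    zero′ : ∀ u v c → u * (c - c) - v * (c - c) ≡ 0ℚ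
    zero′ = solve-∀ ℚ-ring
    cancel : ∀ u v → u * (on′ Q - on′ P) - v * (on′ R - on′ P) ≡ 0ℚ
    cancel u v rewrite on P SP | on Q SQ | on R SR = zero′ u v c
    cancel′ : ∀ u v → u * (on′ R - on′ P) - v * (on′ Q - on′ P) ≡ 0ℚ
    cancel′ u v rewrite on P SP | on Q SQ | on R SR = zero′ u v c

orient-PQP≡0 : ∀ P Q → orient P Q P ≡ 0ℤ
orient-PQP≡0 (px , py) (qx , qy) = eq px py qx qy
  where
  open Data.Integer using (_*_; _-_)
  eq : ∀ px py qx qy → (qx - px) * (py - py) - (qy - py) * (px - px) ≡ 0ℤ
  eq = solve-∀ ℤ-ring

orient-PQQ≡0 : ∀ P Q → orient P Q Q ≡ 0ℤ
orient-PQQ≡0 (px , py) (qx , qy) = eq px py qx qy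
  where
  open Data.Integer using (_*_; _-_)
  eq : ∀ px py qx qy → (qx - px) * (qy - py) - (qy - py) * (qx - px) ≡ 0ℤ
  eq = solve-∀ ℤ-ring

orient≡0⇒Collinear : ∀ A B C → orient A B C ≡ 0ℤ → Collinear (_∈ A ∷ B ∷ C ∷ [])
orient≡0⇒Collinear A B C ABC≡0 with ≡-dec ℤ._≟_ ℤ._≟_ A B | ≡-dec ℤ._≟_ ℤ._≟_ A C
... | no A≢B | _ = let a , b , c , ab≢0 , on = line-through A B A≢B in
  a , b , c , ab≢0 , λ where
    p (here refl)                 → on p (orient-PQP≡0 A B)
    p (there (here refl))         → on p (orient-PQQ≡0 A B)
    p (there (there (here refl))) → on p ABC≡0
... | yes refl | no A≢C = let a , b , c , ab≢0 , on = line-through A C A≢C in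
  a , b , c , ab≢0 , λ where
    p (here refl)                 → on p (orient-PQP≡0 A C)
    p (there (here refl))         → on p (orient-PQP≡0 A C)
    p (there (there (here refl))) → on p (orient-PQQ≡0 A C)
... | yes refl | yes refl = let a , b , c , ab≢0 , on = line-through A Q A≢Q in
  a , b , c , ab≢0 , λ where
    p (here refl)                 → on p (orient-PQP≡0 A Q)
    p (there (here refl))         → on p (orient-PQP≡0 A Q)
    p (there (there (here refl))) → on p (orient-PQP≡0 A Q)
  where
  -- All three points coincide, so any second point determines a line through them.
  Q = ℤ.suc (proj₁ A) , proj₂ A
  A≢Q : A ≢ Q
  A≢Q A≡Q = ℤ.i≢suc[i] (cong proj₁ A≡Q)

module _ (T : LatticeTriangle) where
  open LatticeTriangle T

  area : ℤ
  area = orient A B C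

  area≢0 : area ≢ 0ℤ
  area≢0 D≡0 = nondegenerate (orient≡0⇒Collinear A B C D≡0)

  -- The factor area makes the sign conditions independent of orientation.
  Inside : Lattice → Set
  Inside p = 0ℤ ℤ.< area ℤ.* orient p B C × 0ℤ ℤ.< area ℤ.* orient p C A × 0ℤ ℤ.< area ℤ.* orient p A B

module _ where
  open import Data.Rational using (_+_; _*_; _-_; -_; ∣_∣; _<_; _≤_; _⊓_; 1/_; Positive; NonZero; NonNegative; positive; nonNegative; negative; ≢-nonZero)
  open ℚ.≤-Reasoning

  0<p*p : ∀ {p} → p ≢ 0ℚ → 0ℚ < p * p
  0<p*p {p} p≢0 with ℚ.<-cmp p 0ℚ
  ... | tri< p<0 _ _ = ℚ.positive⁻¹ (p * p) {{ℚ.neg*neg⇒pos p {{negative p<0}} p {{negative p<0}}}}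
  ... | tri≈ _ p≡0 _ = contradiction p≡0 p≢0
  ... | tri> _ _ 0<p = ℚ.positive⁻¹ (p * p) {{ℚ.pos*pos⇒pos p {{positive 0<p}} p {{positive 0<p}}}}

  0≤p*q : ∀ {p q} → 0ℚ ≤ p → 0ℚ ≤ q → 0ℚ ≤ p * q
  0≤p*q {p} {q} 0≤p 0≤q = ℚ.nonNegative⁻¹ (p * q)
    {{ℚ.nonNeg*nonNeg⇒nonNeg p {{nonNegative 0≤p}} q {{nonNegative 0≤q}}}}

  module _ (T : LatticeTriangle) where
    open LatticeTriangle T

    areaℚ : ℚ
    areaℚ = orientℚ (ι A) (ι B) (ι C)

    areaℚ≢0 : areaℚ ≢ 0ℚ
    areaℚ≢0 D≡0 = area≢0 T (⟦⟧-injective (trans (⟦orient⟧ A B C) D≡0))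

    ⟦area*orient⟧ : ∀ p Q R → ⟦ area T ℤ.* orient p Q R ⟧ ≡ areaℚ * orientℚ (ι p) (ι Q) (ι R)
    ⟦area*orient⟧ p Q R = trans (⟦⟧-* (area T) (orient p Q R)) (cong₂ _*_ (⟦orient⟧ A B C) (⟦orient⟧ p Q R))

    Region-rotate : ∀ {P} → Region T P → Region (rotate T) P
    Region-rotate (α , β , γ , 0≤α , 0≤β , 0≤γ , sum , refl) =
      β , γ , α , 0≤β , 0≤γ , 0≤α , trans (cycle β γ α) sum ,
      cong₂ _,_ (sym (cycle (β * _) (γ * _) (α * _))) (sym (cycle (β * _) (γ * _) (α * _)))
      where
      cycle : ∀ β γ α → β + γ + α ≡ α + β + γ
      cycle = solve-∀ ℚ-ring

    Region⇒weight : ∀ {P} → Region T P → 0ℚ ≤ areaℚ * orientℚ P (ι B) (ι C)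
    Region⇒weight (α , β , γ , 0≤α , 0≤β , 0≤γ , sum , refl) = begin
      0ℚ                   ≤⟨ 0≤p*q 0≤α (ℚ.<⇒≤ (0<p*p areaℚ≢0)) ⟩
      α * (areaℚ * areaℚ)  ≡⟨ rearrange α areaℚ ⟩
      areaℚ * (α * areaℚ)  ≡⟨ cong (areaℚ *_) (sym (orientℚ-combination (ι A) (ι B) (ι C) α β γ sum)) ⟩
      areaℚ * orientℚ (α · ι A ⊕ β · ι B ⊕ γ · ι C) (ι B) (ι C) ∎
      where
      rearrange : ∀ α D → α * (D * D) ≡ D * (α * D)
      rearrange = solve-∀ ℚ-ring

    -- The barycentric coordinates are the weights divided by the square of `areaℚ`, which is
    -- positive for either orientation and so preserves signs.
    weights⇒Region : ∀ {P} → 0ℚ ≤ areaℚ * orientℚ P (ι B) (ι C) → 0ℚ ≤ areaℚ * orientℚ P (ι C) (ι A) →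
      0ℚ ≤ areaℚ * orientℚ P (ι A) (ι B) → Region T P
    weights⇒Region {P@(px , py)} 0≤a 0≤b 0≤c =
      α * r , β * r , γ * r , 0≤p*q 0≤a 0≤r , 0≤p*q 0≤b 0≤r , 0≤p*q 0≤c 0≤r ,
      trans (total px py ax ay bx by cx cy r) (ℚ.*-inverseʳ (D * D)) ,
      cong₂ _,_ (coordinate px (combX px py ax ay bx by cx cy r)) (coordinate py (combY px py ax ay bx by cx cy r))
      where
      D = areaℚ
      ax = proj₁ (ι A) ; ay = proj₂ (ι A)
      bx = proj₁ (ι B) ; by = proj₂ (ι B)
      cx = proj₁ (ι C) ; cy = proj₂ (ι C)
      α = D * orientℚ P (ι B) (ι C)
      β = D * orientℚ P (ι C) (ι A)
      γ = D * orientℚ P (ι A) (ι B)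
      instance
        DD-pos : Positive (D * D)
        DD-pos = positive (0<p*p areaℚ≢0)
        DD-nonZero : NonZero (D * D)
        DD-nonZero = ℚ.pos⇒nonZero (D * D)
      r = 1/ (D * D)
      0≤r : 0ℚ ≤ r
      0≤r = ℚ.<⇒≤ (ℚ.positive⁻¹ r {{ℚ.1/pos⇒pos (D * D)}})
      coordinate : ∀ x {y} → y ≡ x * (D * D * r) → x ≡ y
      coordinate x eq = trans (sym (ℚ.*-identityʳ x)) (trans (cong (x *_) (sym (ℚ.*-inverseʳ (D * D)))) (sym eq))
      total : ∀ px py ax ay bx by cx cy r →
        let D = (bx - ax) * (cy - ay) - (by - ay) * (cx - ax)
            α = (bx - px) * (cy - py) - (by - py) * (cx - px)
            β = (cx - px) * (ay - py) - (cy - py) * (ax - px)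
            γ = (ax - px) * (by - py) - (ay - py) * (bx - px)
        in D * α * r + D * β * r + D * γ * r ≡ D * D * r
      total = solve-∀ ℚ-ring
      combX : ∀ px py ax ay bx by cx cy r →
        let D = (bx - ax) * (cy - ay) - (by - ay) * (cx - ax)
            α = (bx - px) * (cy - py) - (by - py) * (cx - px)
            β = (cx - px) * (ay - py) - (cy - py) * (ax - px)
            γ = (ax - px) * (by - py) - (ay - py) * (bx - px)
        in D * α * r * ax + D * β * r * bx + D * γ * r * cx ≡ px * (D * D * r)
      combX = solve-∀ ℚ-ring
      combY : ∀ px py ax ay bx by cx cy r →
        let D = (bx - ax) * (cy - ay) - (by - ay) * (cx - ax)
            α = (bx - px) * (cy - py) - (by - py) * (cx - px)
            β = (cx - px) * (ay - py) - (cy - py) * (ax - px)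
            γ = (ax - px) * (by - py) - (ay - py) * (bx - px)
        in D * α * r * ay + D * β * r * by + D * γ * r * cy ≡ py * (D * D * r)
      combY = solve-∀ ℚ-ring

    InteriorPoint⇒weight : ∀ {p} → InteriorPoint T p → 0ℤ ℤ.< area T ℤ.* orient p B C
    InteriorPoint⇒weight {p} (ε , 0<ε , near) = ⟦⟧-cancel-< (subst (0ℚ <_) (sym (⟦area*orient⟧ p B C)) 0<Da)
      where
      D = areaℚ
      ax = proj₁ (ι A) ; ay = proj₂ (ι A)
      bx = proj₁ (ι B) ; by = proj₂ (ι B)
      cx = proj₁ (ι C) ; cy = proj₂ (ι C)
      px = proj₁ (ι p) ; py = proj₂ (ι p)
      s = shrink ε (px - ax) (py - ay) 0<ε
      δ = proj₁ s
      0<δ = proj₁ (proj₂ s)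
      -- Moving p away from A stays in the region, which forces the weight of A at p to be positive.
      away = px + δ * (px - ax) , py + δ * (py - ay)
      move : ∀ u d → u + d - u ≡ d
      move = solve-∀ ℚ-ring
      away∈ : Region T away
      away∈ = near _ _
        (subst (λ t → ∣ t ∣ < ε) (sym (move px _)) (proj₁ (proj₂ (proj₂ s))))
        (subst (λ t → ∣ t ∣ < ε) (sym (move py _)) (proj₂ (proj₂ (proj₂ s))))
      -- The weight is affine in the point and equals `D * D` at `A`, so moving from `A` past `p` by
      -- the factor `δ` gives `1 + δ` times the weight at `p`, less `δ` times the weight at `A`.
      extrapolate : ∀ px py ax ay bx by cx cy δ →
        let D = (bx - ax) * (cy - ay) - (by - ay) * (cx - ax)
            px′ = px + δ * (px - ax)
            py′ = py + δ * (py - ay)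
        in D * ((bx - px′) * (cy - py′) - (by - py′) * (cx - px′))
           ≡ (1ℚ + δ) * (D * ((bx - px) * (cy - py) - (by - py) * (cx - px))) + - (δ * (D * D))
      extrapolate = solve-∀ ℚ-ring
      instance
        1+δ-nonNeg : NonNegative (1ℚ + δ)
        1+δ-nonNeg = nonNegative (ℚ.+-mono-≤ (ℚ.nonNegative⁻¹ 1ℚ) (ℚ.<⇒≤ 0<δ))
      0<δDD : 0ℚ < δ * (D * D)
      0<δDD = ℚ.positive⁻¹ _ {{ℚ.pos*pos⇒pos δ {{positive 0<δ}} (D * D) {{positive (0<p*p areaℚ≢0)}}}}
      0<Da : 0ℚ < D * orientℚ (ι p) (ι B) (ι C)
      0<Da = ℚ.≰⇒> λ Da≤0 → ℚ.<-irrefl refl (begin-strict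
        0ℚ                                    ≤⟨ Region⇒weight away∈ ⟩
        D * orientℚ away (ι B) (ι C)          ≡⟨ extrapolate px py ax ay bx by cx cy δ ⟩
        (1ℚ + δ) * (D * orientℚ (ι p) (ι B) (ι C)) + - (δ * (D * D))
          ≤⟨ ℚ.+-monoˡ-≤ (- (δ * (D * D))) (ℚ.*-monoˡ-≤-nonNeg (1ℚ + δ) Da≤0) ⟩
        (1ℚ + δ) * 0ℚ + - (δ * (D * D))       ≡⟨ cong (_+ - (δ * (D * D))) (ℚ.*-zeroʳ (1ℚ + δ)) ⟩
        0ℚ + - (δ * (D * D))                  ≡⟨ ℚ.+-identityˡ _ ⟩
        - (δ * (D * D))                       <⟨ ℚ.neg-antimono-< 0<δDD ⟩
        0ℚ                                    ∎)

    weight-nonneg-near : ∀ {p} Q R → 0ℤ ℤ.< area T ℤ.* orient p Q R →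
      ∃[ ε ] 0ℚ < ε × (∀ x y → ∣ x - proj₁ (ι p) ∣ < ε → ∣ y - proj₂ (ι p) ∣ < ε →
        0ℚ ≤ areaℚ * orientℚ (x , y) (ι Q) (ι R))
    weight-nonneg-near {p} Q R 0<w = ε , 0<ε , λ x y dx dy →
        subst (0ℚ ≤_) (expand D px py x y (proj₁ (ι Q)) (proj₂ (ι Q)) (proj₁ (ι R)) (proj₂ (ι R)))
          (near (x - px) (y - py) dx dy)
      where
      D = areaℚ
      px = proj₁ (ι p) ; py = proj₂ (ι p)
      expand : ∀ D px py x y qx qy rx ry →
        D * ((qx - px) * (ry - py) - (qy - py) * (rx - px)) + (D * (qy - ry) * (x - px) + D * (rx - qx) * (y - py))
        ≡ D * ((qx - x) * (ry - y) - (qy - y) * (rx - x))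
      expand = solve-∀ ℚ-ring
      a = affine-nonneg-near (D * orientℚ (ι p) (ι Q) (ι R))
            (D * (proj₂ (ι Q) - proj₂ (ι R))) (D * (proj₁ (ι R) - proj₁ (ι Q)))
            (subst (0ℚ <_) (⟦area*orient⟧ p Q R) (⟦⟧-mono-< 0<w))
      ε = proj₁ a
      0<ε = proj₁ (proj₂ a)
      near = proj₂ (proj₂ a)

    Inside⇒InteriorPoint : ∀ {p} → Inside T p → InteriorPoint T p
    Inside⇒InteriorPoint (0<a , 0<b , 0<c) =
      let ε₁ , 0<ε₁ , near₁ = weight-nonneg-near B C 0<a
          ε₂ , 0<ε₂ , near₂ = weight-nonneg-near C A 0<b
          ε₃ , 0<ε₃ , near₃ = weight-nonneg-near A B 0<c
          ε≤₁ = ℚ.≤-trans (ℚ.p⊓q≤p (ε₁ ⊓ ε₂) ε₃) (ℚ.p⊓q≤p ε₁ ε₂)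
          ε≤₂ = ℚ.≤-trans (ℚ.p⊓q≤p (ε₁ ⊓ ε₂) ε₃) (ℚ.p⊓q≤q ε₁ ε₂)
          ε≤₃ = ℚ.p⊓q≤q (ε₁ ⊓ ε₂) ε₃
      in ε₁ ⊓ ε₂ ⊓ ε₃ , 0<⊓ (0<⊓ 0<ε₁ 0<ε₂) 0<ε₃ , λ x y dx dy → weights⇒Region
          (near₁ x y (ℚ.<-≤-trans dx ε≤₁) (ℚ.<-≤-trans dy ε≤₁))
          (near₂ x y (ℚ.<-≤-trans dx ε≤₂) (ℚ.<-≤-trans dy ε≤₂))
          (near₃ x y (ℚ.<-≤-trans dx ε≤₃) (ℚ.<-≤-trans dy ε≤₃))
      where
      0<⊓ : ∀ {p q} → 0ℚ < p → 0ℚ < q → 0ℚ < p ⊓ q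
      0<⊓ {p} {q} 0<p 0<q with ℚ.⊓-sel p q
      ... | inj₁ eq = subst (0ℚ <_) (sym eq) 0<p
      ... | inj₂ eq = subst (0ℚ <_) (sym eq) 0<q

  InteriorPoint-rotate : ∀ T {p} → InteriorPoint T p → InteriorPoint (rotate T) p
  InteriorPoint-rotate T (ε , 0<ε , near) = ε , 0<ε , λ x y dx dy → Region-rotate T (near x y dx dy)

orient-rotate : ∀ P Q R → orient P Q R ≡ orient Q R P
orient-rotate (px , py) (qx , qy) (rx , ry) = eq px py qx qy rx ry
  where
  open Data.Integer using (_*_; _-_)
  eq : ∀ px py qx qy rx ry → (qx - px) * (ry - py) - (qy - py) * (rx - px)
       ≡ (rx - qx) * (py - qy) - (ry - qy) * (px - qx)
  eq = solve-∀ ℤ-ring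

-- The weights of `B` and `C` are those of the first vertex in the rotated triangles, which have the
-- same area.
InteriorPoint⇔Inside : ∀ T p → InteriorPoint T p ⇔ Inside T p
InteriorPoint⇔Inside T p = mk⇔ to (Inside⇒InteriorPoint T)
  where
  open LatticeTriangle T
  to : InteriorPoint T p → Inside T p
  to i = InteriorPoint⇒weight T {p} i
       , subst (λ D → 0ℤ ℤ.< D ℤ.* orient p C A) (sym (orient-rotate A B C))
           (InteriorPoint⇒weight (rotate T) {p} i′)
       , subst (λ D → 0ℤ ℤ.< D ℤ.* orient p A B) (orient-rotate C A B)
           (InteriorPoint⇒weight (rotate (rotate T)) {p} i″)
    where
    i′ : InteriorPoint (rotate T) p
    i′ = InteriorPoint-rotate T {p} i
    i″ : InteriorPoint (rotate (rotate T)) p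
    i″ = InteriorPoint-rotate (rotate T) {p} i′

-- Exact cardinalities of sets of lattice points

length-cartesianProduct : ∀ {X Y : Set} (xs : List X) (ys : List Y) →
  length (cartesianProduct xs ys) ≡ length xs ℕ.* length ys
length-cartesianProduct []       ys = refl
length-cartesianProduct (x ∷ xs) ys = trans (length-++ (map (x ,_) ys))
  (cong₂ ℕ._+_ (length-map (x ,_) ys) (length-cartesianProduct xs ys))

-- Two duplicate-free lists with the same elements are permutations of each other.
HasExactly-unique : ∀ {m n S} → HasExactly m S → HasExactly n S → m ≡ n
HasExactly-unique (ps , ps! , refl , ∈ps⇔) (qs , qs! , refl , ∈qs⇔) =
  ↭-length (∼bag⇒↭ (unique∧set⇒bag ps! qs! (λ {p} → ⇔.trans (∈ps⇔ p) (⇔.sym (∈qs⇔ p)))))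

HasExactly-cong : ∀ {n S S′} → (∀ p → S p ⇔ S′ p) → HasExactly n S → HasExactly n S′
HasExactly-cong S⇔S′ (ps , ps! , len , ∈ps⇔) = ps , ps! , len , λ p → ⇔.trans (∈ps⇔ p) (S⇔S′ p)

HasExactly-image : ∀ {X : Set} {xs : List X} → Unique xs → (∀ x → x ∈ xs) →
  (f : X → Lattice) → (∀ {x y} → f x ≡ f y → x ≡ y) → HasExactly (length xs) (λ p → ∃[ x ] p ≡ f x)
HasExactly-image {xs = xs} xs! all∈ f f-injective =
  map f xs , Unique.map⁺ f-injective xs! , length-map f xs , λ p → mk⇔
    (λ p∈ → let x , _ , eq = ∈-map⁻ f p∈ in x , eq)
    (λ { (x , refl) → ∈-map⁺ f (all∈ x) })

HasExactly-⊎ : ∀ {m n S S′} → (∀ p → S p → S′ p → ⊥) → HasExactly m S → HasExactly n S′ →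
  HasExactly (m ℕ.+ n) (λ p → S p ⊎ S′ p)
HasExactly-⊎ {S = S} {S′} disjoint (ps , ps! , refl , ∈ps⇔) (qs , qs! , refl , ∈qs⇔) =
  ps ++ qs , Unique.++⁺ ps! qs! (λ {p} (p∈ps , p∈qs) → disjoint p (to (∈ps⇔ p) p∈ps) (to (∈qs⇔ p) p∈qs)) ,
  length-++ ps , λ p → mk⇔ (split p) (join p)
  where
  open Equivalence
  split : ∀ p → p ∈ ps ++ qs → S p ⊎ S′ p
  split p p∈ with ∈-++⁻ ps p∈
  ... | inj₁ p∈ps = inj₁ (to (∈ps⇔ p) p∈ps)
  ... | inj₂ p∈qs = inj₂ (to (∈qs⇔ p) p∈qs)
  join : ∀ p → S p ⊎ S′ p → p ∈ ps ++ qs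
  join p (inj₁ Sp)  = ∈-++⁺ˡ (from (∈ps⇔ p) Sp)
  join p (inj₂ S′p) = ∈-++⁺ʳ ps (from (∈qs⇔ p) S′p)

-- Lattice points on the boundary

step : Lattice → Lattice → ℤ → Lattice
step (px , py) (ex , ey) i = px ℤ.+ i ℤ.* ex , py ℤ.+ i ℤ.* ey

-- Coprimality in Bézout form: `(u , v)` is an integral functional with value 1 on `e`. It reads off
-- positions along a line in direction `e` and later completes `e` to a lattice basis.
Primitive : Lattice → Set
Primitive (ex , ey) = ∃[ u ] ∃[ v ] u ℤ.* ex ℤ.+ v ℤ.* ey ≡ 1ℤ

step-injective : ∀ P e {i j} → Primitive e → step P e i ≡ step P e j → i ≡ j
step-injective (px , py) (ex , ey) {i} {j} (u , v , prim) eq = begin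
  i       ≡⟨ coord i ⟩
  c i     ≡⟨ cong₂ (λ x y → u * (x - px) + v * (y - py)) (cong proj₁ eq) (cong proj₂ eq) ⟩
  c j     ≡⟨ sym (coord j) ⟩
  j       ∎
  where
  open ≡-Reasoning
  open Data.Integer using (_*_; _+_; _-_)
  c : ℤ → ℤ
  c i = u * (px + i * ex - px) + v * (py + i * ey - py)
  expand : ∀ px py ex ey u v i → i * (u * ex + v * ey) ≡ u * (px + i * ex - px) + v * (py + i * ey - py)
  expand = solve-∀ ℤ-ring
  coord : ∀ i → i ≡ c i
  coord i = trans (sym (ℤ.*-identityʳ i)) (trans (cong (i *_) (sym prim)) (expand px py ex ey u v i))

-- Here `g` is the gcd of the coordinate differences, the lattice length of the edge.
record Edge (P Q : Lattice) (g : ℕ) (e : Lattice) : Set where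
  field
    length>0    : 0 ℕ.< g
    isPrimitive : Primitive e
    endpoint    : Q ≡ step P e (+ g)

module _ where
  open Data.Integer using (_*_; _+_; _-_; -_; ∣_∣)

  -- Over the naturals the identity has two forms, according to which product is larger. Signed
  -- coefficients merge them, the second by exchanging `m` and `n`.
  bézoutℤ : ∀ {d m n} → Bézout.Identity d m n → ∃[ x ] ∃[ y ] x * + m + y * + n ≡ + d
  bézoutℤ {d} {m} {n} (Bézout.+- x y eq) = + x , - (+ y) , (begin
    + x * + m + (- (+ y)) * + n    ≡⟨ cong (_+ (- (+ y)) * + n) (sym (ℤ.pos-* x m)) ⟩
    + (x ℕ.* m) + (- (+ y)) * + n  ≡⟨ cong (λ t → + t + (- (+ y)) * + n) (sym eq) ⟩
    + (d ℕ.+ y ℕ.* n) + (- (+ y)) * + n  ≡⟨ cong (λ t → + d + t + (- (+ y)) * + n) (ℤ.pos-* y n) ⟩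
    + d + + y * + n + (- (+ y)) * + n  ≡⟨ cancel (+ d) (+ y) (+ n) ⟩
    + d ∎)
    where
    open ≡-Reasoning
    cancel : ∀ d y n → d + y * n + (- y) * n ≡ d
    cancel = solve-∀ ℤ-ring
  bézoutℤ {d} {m} {n} identity@(Bézout.-+ x y eq) =
    let y′ , x′ , eq′ = bézoutℤ (Bézout.Identity.sym identity) in x′ , y′ , trans (ℤ.+-comm (x′ * + m) (y′ * + n)) eq′

  sign-split : ∀ d → ∃[ s ] s * s ≡ 1ℤ × d ≡ s * + ∣ d ∣
  sign-split (+ n)    = 1ℤ , refl , sym (ℤ.*-identityˡ (+ n))
  sign-split -[1+ n ] = ℤ.-1ℤ , refl , sym (ℤ.-1*i≡-i (+ suc n))

  edge : ∀ P Q → P ≢ Q → ∃[ g ] ∃[ e ] Edge P Q g e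
  edge P@(px , py) Q@(qx , qy) P≢Q
    with Bézout.lemma ∣ qx - px ∣ ∣ qy - py ∣
  ... | Bézout.result g gcd bézout = g , e , record
    { length>0    = ℕ.n≢0⇒n>0 g≢0
    ; isPrimitive = sx * x , sy * y , prim
    ; endpoint    = endpoint
    }
    where
    open ≡-Reasoning
    scaled : ∀ d → g ∣ℕ ∣ d ∣ → ∃[ s ] ∃[ k ] s * s ≡ 1ℤ × + ∣ d ∣ ≡ k * + g × d ≡ + g * (s * k)
    scaled d (divides k eq) with sign-split d
    ... | s , ss≡1 , d≡ = s , + k , ss≡1 , ∣d∣≡ , trans d≡ (trans (cong (s *_) ∣d∣≡) (comm s (+ k) (+ g)))
      where
      ∣d∣≡ : + ∣ d ∣ ≡ + k * + g
      ∣d∣≡ = trans (cong +_ eq) (ℤ.pos-* k g)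
      comm : ∀ s k G → s * (k * G) ≡ G * (s * k)
      comm = solve-∀ ℤ-ring
    X = scaled (qx - px) (GCD.gcd∣m gcd)
    Y = scaled (qy - py) (GCD.gcd∣n gcd)
    sx = proj₁ X ; kx = proj₁ (proj₂ X)
    sy = proj₁ Y ; ky = proj₁ (proj₂ Y)
    x = proj₁ (bézoutℤ bézout) ; y = proj₁ (proj₂ (bézoutℤ bézout))
    e : Lattice
    e = sx * kx , sy * ky
    displace : ∀ {p q t} → q - p ≡ t → q ≡ p + t
    displace {p} {q} eq = trans (split q p) (cong (λ t → p + t) eq)
      where
      split : ∀ q p → q ≡ p + (q - p)
      split = solve-∀ ℤ-ring
    endpoint : Q ≡ step P e (+ g)
    endpoint = cong₂ _,_ (displace (proj₂ (proj₂ (proj₂ (proj₂ X))))) (displace (proj₂ (proj₂ (proj₂ (proj₂ Y)))))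
    g≢0 : g ≢ 0
    g≢0 refl = P≢Q (sym (trans endpoint (cong₂ _,_ (stay px (sx * kx)) (stay py (sy * ky)))))
      where
      stay : ∀ p t → p + 0ℤ * t ≡ p
      stay = solve-∀ ℤ-ring
    -- After multiplication by `g` this is Bézout's identity for the absolute differences; each sign
    -- occurs squared and disappears.
    prim : sx * x * (sx * kx) + sy * y * (sy * ky) ≡ 1ℤ
    prim = ℤ.*-cancelʳ-≡ _ _ (+ g) {{ℤ.≢-nonZero λ g≡0 → g≢0 (ℤ.+-injective g≡0)}} (begin
      (sx * x * (sx * kx) + sy * y * (sy * ky)) * + g
        ≡⟨ regroup sx sy x y kx ky (+ g) ⟩
      sx * sx * (x * (kx * + g)) + sy * sy * (y * (ky * + g))
        ≡⟨ cong₂ (λ a b → a * (x * (kx * + g)) + b * (y * (ky * + g))) (proj₁ (proj₂ (proj₂ X))) (proj₁ (proj₂ (proj₂ Y))) ⟩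
      1ℤ * (x * (kx * + g)) + 1ℤ * (y * (ky * + g))
        ≡⟨ cong₂ (λ a b → 1ℤ * (x * a) + 1ℤ * (y * b)) (sym (proj₁ (proj₂ (proj₂ (proj₂ X))))) (sym (proj₁ (proj₂ (proj₂ (proj₂ Y))))) ⟩
      1ℤ * (x * + ∣ qx - px ∣) + 1ℤ * (y * + ∣ qy - py ∣)
        ≡⟨ cong₂ _+_ (ℤ.*-identityˡ (x * + ∣ qx - px ∣)) (ℤ.*-identityˡ (y * + ∣ qy - py ∣)) ⟩
      x * + ∣ qx - px ∣ + y * + ∣ qy - py ∣
        ≡⟨ proj₂ (proj₂ (bézoutℤ bézout)) ⟩
      + g ≡⟨ sym (ℤ.*-identityˡ (+ g)) ⟩
      1ℤ * + g ∎)
      where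
      regroup : ∀ s t x y kx ky g → (s * x * (s * kx) + t * y * (t * ky)) * g
        ≡ s * s * (x * (kx * g)) + t * t * (y * (ky * g))
      regroup = solve-∀ ℤ-ring

module _ where
  open Data.Rational using (_+_; _*_; _-_; -_; _≤_; 1/_; NonNegative; NonZero; Positive; positive)
  open ≡-Reasoning

  ⟦+*⟧ : ∀ p i e → ⟦ p ℤ.+ i ℤ.* e ⟧ ≡ ⟦ p ⟧ + ⟦ i ⟧ * ⟦ e ⟧
  ⟦+*⟧ p i e = trans (⟦⟧-+ p (i ℤ.* e)) (cong (λ t → ⟦ p ⟧ + t) (⟦⟧-* i e))

  -- The Bézout functional of `e` is integral on `r - P` and takes the value `t g` there, so the
  -- rational `t g` is an integer, and it lies between 0 and `g`.
  Segment⇒step : ∀ {P Q g e r} → Edge P Q g e → Segment (ι P) (ι Q) (ι r) →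
    ∃[ i ] i ℕ.≤ g × r ≡ step P e (+ i)
  Segment⇒step {P@(px , py)} {_} {g} {e@(ex , ey)} {r@(rx , ry)}
    record { isPrimitive = u , v , prim ; endpoint = refl } (t , 0≤t , t≤1 , eq) =
    ℤ.∣ j ∣ , ℤ.drop‿+≤+ (subst (ℤ._≤ + g) (sym +∣j∣≡j) j≤g) ,
    trans (cong₂ _,_ (coordinate rx px ex x-eq) (coordinate ry py ey y-eq)) (cong (step P e) (sym +∣j∣≡j))
    where
    j = u ℤ.* (rx ℤ.- px) ℤ.+ v ℤ.* (ry ℤ.- py)
    tg = t * ⟦ + g ⟧
    offset : ∀ p e → (1ℚ - t) * ⟦ p ⟧ + t * ⟦ p ℤ.+ + g ℤ.* e ⟧ ≡ ⟦ p ⟧ + tg * ⟦ e ⟧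
    offset p e = trans (cong (λ q → (1ℚ - t) * ⟦ p ⟧ + t * q) (⟦+*⟧ p (+ g) e)) (expand t ⟦ p ⟧ ⟦ + g ⟧ ⟦ e ⟧)
      where
      expand : ∀ t p g e → (1ℚ - t) * p + t * (p + g * e) ≡ p + t * g * e
      expand = solve-∀ ℚ-ring
    x-eq : ⟦ rx ⟧ ≡ ⟦ px ⟧ + tg * ⟦ ex ⟧
    x-eq = trans (cong proj₁ eq) (offset px ex)
    y-eq : ⟦ ry ⟧ ≡ ⟦ py ⟧ + tg * ⟦ ey ⟧
    y-eq = trans (cong proj₂ eq) (offset py ey)
    ⟦j⟧ : ⟦ j ⟧ ≡ tg
    ⟦j⟧ = begin
      ⟦ j ⟧
        ≡⟨ ⟦⟧-+ (u ℤ.* (rx ℤ.- px)) (v ℤ.* (ry ℤ.- py)) ⟩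
      ⟦ u ℤ.* (rx ℤ.- px) ⟧ + ⟦ v ℤ.* (ry ℤ.- py) ⟧
        ≡⟨ cong₂ _+_ (part u rx px) (part v ry py) ⟩
      ⟦ u ⟧ * (⟦ rx ⟧ - ⟦ px ⟧) + ⟦ v ⟧ * (⟦ ry ⟧ - ⟦ py ⟧)
        ≡⟨ cong₂ (λ x y → ⟦ u ⟧ * (x - ⟦ px ⟧) + ⟦ v ⟧ * (y - ⟦ py ⟧)) x-eq y-eq ⟩
      ⟦ u ⟧ * (⟦ px ⟧ + tg * ⟦ ex ⟧ - ⟦ px ⟧) + ⟦ v ⟧ * (⟦ py ⟧ + tg * ⟦ ey ⟧ - ⟦ py ⟧)
        ≡⟨ collect ⟦ u ⟧ ⟦ v ⟧ ⟦ px ⟧ ⟦ py ⟧ tg ⟦ ex ⟧ ⟦ ey ⟧ ⟩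
      tg * (⟦ u ⟧ * ⟦ ex ⟧ + ⟦ v ⟧ * ⟦ ey ⟧)
        ≡⟨ cong (λ x → tg * (x + ⟦ v ⟧ * ⟦ ey ⟧)) (sym (⟦⟧-* u ex)) ⟩
      tg * (⟦ u ℤ.* ex ⟧ + ⟦ v ⟧ * ⟦ ey ⟧)
        ≡⟨ cong (tg *_) (sym (⟦+*⟧ (u ℤ.* ex) v ey)) ⟩
      tg * ⟦ u ℤ.* ex ℤ.+ v ℤ.* ey ⟧
        ≡⟨ cong (λ x → tg * ⟦ x ⟧) prim ⟩
      tg * 1ℚ
        ≡⟨ ℚ.*-identityʳ tg ⟩
      tg ∎
      where
      part : ∀ u r p → ⟦ u ℤ.* (r ℤ.- p) ⟧ ≡ ⟦ u ⟧ * (⟦ r ⟧ - ⟦ p ⟧)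
      part u r p = trans (⟦⟧-* u (r ℤ.- p)) (cong (⟦ u ⟧ *_) (⟦⟧-- r p))
      collect : ∀ u v px py t ex ey →
        u * (px + t * ex - px) + v * (py + t * ey - py) ≡ t * (u * ex + v * ey)
      collect = solve-∀ ℚ-ring
    coordinate : ∀ r p e → ⟦ r ⟧ ≡ ⟦ p ⟧ + tg * ⟦ e ⟧ → r ≡ p ℤ.+ j ℤ.* e
    coordinate r p e r≡ = ⟦⟧-injective (trans r≡
      (trans (cong (λ t → ⟦ p ⟧ + t * ⟦ e ⟧) (sym ⟦j⟧)) (sym (⟦+*⟧ p j e))))
    0≤g : 0ℚ ≤ ⟦ + g ⟧
    0≤g = ⟦⟧-mono-≤ {0ℤ} {+ g} (+≤+ z≤n)
    0≤j : 0ℤ ℤ.≤ j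
    0≤j = ⟦⟧-cancel-≤ {0ℤ} {j} (subst (0ℚ ≤_) (sym ⟦j⟧) (0≤p*q 0≤t 0≤g))
    j≤g : j ℤ.≤ + g
    j≤g = ⟦⟧-cancel-≤ {j} {+ g} (subst₂ _≤_ (sym ⟦j⟧) (ℚ.*-identityˡ ⟦ + g ⟧)
      (ℚ.*-monoʳ-≤-nonNeg ⟦ + g ⟧ {{ℚ.nonNegative 0≤g}} t≤1))
    +∣j∣≡j : + ℤ.∣ j ∣ ≡ j
    +∣j∣≡j = ℤ.0≤i⇒+∣i∣≡i 0≤j

  step⇒Segment : ∀ {P Q g e i} → Edge P Q g e → i ℕ.≤ g → Segment (ι P) (ι Q) (ι (step P e (+ i)))
  step⇒Segment {P@(px , py)} {_} {g} {e@(ex , ey)} {i} record { length>0 = 0<g ; endpoint = refl } i≤g =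
    t , 0≤p*q (⟦⟧-mono-≤ {0ℤ} {+ i} (+≤+ z≤n)) 0≤1/G , t≤1 , cong₂ _,_ (coordinate px ex) (coordinate py ey)
    where
    G = ⟦ + g ⟧
    instance
      G-pos : Positive G
      G-pos = positive (⟦⟧-mono-< {0ℤ} {+ g} (ℤ.+<+ 0<g))
      G-nonZero : NonZero G
      G-nonZero = ℚ.pos⇒nonZero G
      1/G-pos : Positive (1/ G)
      1/G-pos = ℚ.1/pos⇒pos G
    0≤1/G : 0ℚ ≤ 1/ G
    0≤1/G = ℚ.<⇒≤ (ℚ.positive⁻¹ (1/ G))
    t = ⟦ + i ⟧ * 1/ G
    t≤1 : t ≤ 1ℚ
    t≤1 = subst (t ≤_) (ℚ.*-inverseʳ G)
      (ℚ.*-monoʳ-≤-nonNeg (1/ G) {{ℚ.nonNegative 0≤1/G}} (⟦⟧-mono-≤ {+ i} {+ g} (+≤+ i≤g)))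
    tG≡i : t * G ≡ ⟦ + i ⟧
    tG≡i = trans (ℚ.*-assoc ⟦ + i ⟧ (1/ G) G) (trans (cong (⟦ + i ⟧ *_) (ℚ.*-inverseˡ G)) (ℚ.*-identityʳ ⟦ + i ⟧))
    coordinate : ∀ p e → ⟦ p ℤ.+ + i ℤ.* e ⟧ ≡ (1ℚ - t) * ⟦ p ⟧ + t * ⟦ p ℤ.+ + g ℤ.* e ⟧
    coordinate p e = begin
      ⟦ p ℤ.+ + i ℤ.* e ⟧             ≡⟨ ⟦+*⟧ p (+ i) e ⟩
      ⟦ p ⟧ + ⟦ + i ⟧ * ⟦ e ⟧         ≡⟨ cong (λ s → ⟦ p ⟧ + s * ⟦ e ⟧) (sym tG≡i) ⟩
      ⟦ p ⟧ + t * G * ⟦ e ⟧           ≡⟨ expand t ⟦ p ⟧ G ⟦ e ⟧ ⟩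
      (1ℚ - t) * ⟦ p ⟧ + t * (⟦ p ⟧ + G * ⟦ e ⟧)
        ≡⟨ cong (λ q → (1ℚ - t) * ⟦ p ⟧ + t * q) (sym (⟦+*⟧ p (+ g) e)) ⟩
      (1ℚ - t) * ⟦ p ⟧ + t * ⟦ p ℤ.+ + g ℤ.* e ⟧ ∎
      where
      expand : ∀ t p g e → p + t * g * e ≡ (1ℚ - t) * p + t * (p + g * e)
      expand = solve-∀ ℚ-ring

module _ where
  open Data.Integer using (_*_; _+_; _-_; -_; ∣_∣)
  open ≡-Reasoning

  -- Omitting the far endpoint makes the three edges of a triangle disjoint while they still cover
  -- the boundary, so lattice lengths simply add up.
  HalfOpen : Lattice → ℕ → Lattice → Lattice → Set
  HalfOpen P g e p = ∃[ i ] p ≡ step P e (+ toℕ {g} i)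

  HalfOpen-count : ∀ {P g e} → Primitive e → HasExactly g (HalfOpen P g e)
  HalfOpen-count {P} {g} {e} prim = subst (λ n → HasExactly n (HalfOpen P g e)) (length-tabulate {n = g} (λ i → i))
    (HasExactly-image (Unique.allFin⁺ g) ∈-allFin (λ i → step P e (+ toℕ i))
      (λ eq → Fin.toℕ-injective (ℤ.+-injective (step-injective P e prim eq))))

  step-0 : ∀ P e → step P e 0ℤ ≡ P
  step-0 (px , py) (ex , ey) = cong₂ _,_ (eq px ex) (eq py ey)
    where
    eq : ∀ p e → p + 0ℤ * e ≡ p
    eq = solve-∀ ℤ-ring

  Segment⇒HalfOpen : ∀ {P Q g e g′ e′ r} → Edge P Q g e → 0 ℕ.< g′ → Segment (ι P) (ι Q) (ι r) →
    HalfOpen P g e r ⊎ HalfOpen Q g′ e′ r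
  Segment⇒HalfOpen {P} {Q} {g} {e} {g′} {e′} {r} E 0<g′ seg with Segment⇒step {r = r} E seg
  ... | i , i≤g , refl with ℕ.m≤n⇒m<n∨m≡n i≤g
  ... | inj₁ i<g = inj₁ (fromℕ< i<g , cong (λ j → step P e (+ j)) (sym (Fin.toℕ-fromℕ< i<g)))
  ... | inj₂ refl = inj₂ (fromℕ< 0<g′ , (begin
      step P e (+ g)                       ≡⟨ sym (Edge.endpoint E) ⟩
      Q                                    ≡⟨ sym (step-0 Q e′) ⟩
      step Q e′ 0ℤ                         ≡⟨ cong (λ j → step Q e′ (+ j)) (sym (Fin.toℕ-fromℕ< 0<g′)) ⟩
      step Q e′ (+ toℕ (fromℕ< 0<g′))      ∎))

  HalfOpen⇒Segment : ∀ {P Q g e r} → Edge P Q g e → HalfOpen P g e r → Segment (ι P) (ι Q) (ι r)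
  HalfOpen⇒Segment E (i , refl) = step⇒Segment E (ℕ.<⇒≤ (Fin.toℕ<n i))

  HalfOpen⇒orient≡0 : ∀ {P Q g e r} → Edge P Q g e → HalfOpen P g e r → orient r P Q ≡ 0ℤ
  HalfOpen⇒orient≡0 {P@(px , py)} {_} {g} {e@(ex , ey)} record { endpoint = refl } (i , refl) =
    eq px py ex ey (+ g) (+ toℕ i)
    where
    eq : ∀ px py ex ey g i →
      (px - (px + i * ex)) * (py + g * ey - (py + i * ey)) - (py - (py + i * ey)) * (px + g * ex - (px + i * ex)) ≡ 0ℤ
    eq = solve-∀ ℤ-ring

  -- Along the edge the determinant is affine: at index `i` it is `(g - i) / g` times its value at
  -- `P`. It vanishes only at `Q`, which is left out.
  HalfOpen⇒orient≢0 : ∀ {P Q g e r} R → Edge P Q g e → orient P Q R ≢ 0ℤ → HalfOpen P g e r → orient r Q R ≢ 0ℤ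
  HalfOpen⇒orient≢0 {P@(px , py)} {Q} {g} {e@(ex , ey)} R@(rx , ry) record { endpoint = refl } PQR≢0 (i , refl) rQR≡0 =
    nonzero (ℤ.i*j≡0⇒i≡0∨j≡0 (+ g - + toℕ i) (begin
      (+ g - + toℕ i) * orient P Q R                ≡⟨ sym (eq px py ex ey rx ry (+ g) (+ toℕ i)) ⟩
      + g * orient (step P e (+ toℕ i)) Q R         ≡⟨ cong (+ g *_) rQR≡0 ⟩
      + g * 0ℤ                                      ≡⟨ ℤ.*-zeroʳ (+ g) ⟩
      0ℤ                                            ∎))
    where
    eq : ∀ px py ex ey rx ry g i →
      g * ((px + g * ex - (px + i * ex)) * (ry - (py + i * ey)) - (py + g * ey - (py + i * ey)) * (rx - (px + i * ex)))
      ≡ (g - i) * ((px + g * ex - px) * (ry - py) - (py + g * ey - py) * (rx - px))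
    eq = solve-∀ ℤ-ring
    nonzero : + g - + toℕ i ≡ 0ℤ ⊎ orient P Q R ≡ 0ℤ → ⊥
    nonzero (inj₁ g-i≡0) = ℕ.<⇒≢ (Fin.toℕ<n i) (sym (ℤ.+-injective (ℤ.i-j≡0⇒i≡j (+ g) (+ toℕ i) g-i≡0)))
    nonzero (inj₂ PQR≡0) = PQR≢0 PQR≡0

BoundaryPoint-count : ∀ T {g₁ g₂ g₃ e₁ e₂ e₃} → let open LatticeTriangle T in
  Edge A B g₁ e₁ → Edge B C g₂ e₂ → Edge C A g₃ e₃ →
  HasExactly (g₁ ℕ.+ (g₂ ℕ.+ g₃)) (BoundaryPoint T)
BoundaryPoint-count T {g₁} {g₂} {g₃} {e₁} {e₂} {e₃} E₁ E₂ E₃ = HasExactly-cong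
  (λ p → mk⇔ (to p) (from p))
  (HasExactly-⊎ disjoint₁ (HalfOpen-count {A} (Edge.isPrimitive E₁))
    (HasExactly-⊎ disjoint₂ (HalfOpen-count {B} (Edge.isPrimitive E₂)) (HalfOpen-count {C} (Edge.isPrimitive E₃))))
  where
  open LatticeTriangle T
  H₁ = HalfOpen A g₁ e₁ ; H₂ = HalfOpen B g₂ e₂ ; H₃ = HalfOpen C g₃ e₃
  BCA≢0 : orient B C A ≢ 0ℤ
  BCA≢0 eq = area≢0 T (trans (orient-rotate A B C) eq)
  CAB≢0 : orient C A B ≢ 0ℤ
  CAB≢0 eq = BCA≢0 (trans (orient-rotate B C A) eq)
  -- Each half-open edge avoids the line of the edge after it, and of any two edges of a triangle
  -- one comes right after the other.
  disjoint₂ : ∀ p → H₂ p → H₃ p → ⊥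
  disjoint₂ p h₂ h₃ = HalfOpen⇒orient≢0 A E₂ BCA≢0 h₂ (HalfOpen⇒orient≡0 E₃ h₃)
  disjoint₁ : ∀ p → H₁ p → H₂ p ⊎ H₃ p → ⊥
  disjoint₁ p h₁ (inj₁ h₂) = HalfOpen⇒orient≢0 C E₁ (area≢0 T) h₁ (HalfOpen⇒orient≡0 E₂ h₂)
  disjoint₁ p h₁ (inj₂ h₃) = HalfOpen⇒orient≢0 B E₃ CAB≢0 h₃ (HalfOpen⇒orient≡0 E₁ h₁)
  to : ∀ p → H₁ p ⊎ H₂ p ⊎ H₃ p → BoundaryPoint T p
  to p (inj₁ h)        = inj₁ (HalfOpen⇒Segment E₁ h)
  to p (inj₂ (inj₁ h)) = inj₂ (inj₁ (HalfOpen⇒Segment E₂ h))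
  to p (inj₂ (inj₂ h)) = inj₂ (inj₂ (HalfOpen⇒Segment E₃ h))
  from : ∀ p → BoundaryPoint T p → H₁ p ⊎ H₂ p ⊎ H₃ p
  from p (inj₁ s) with Segment⇒HalfOpen {g′ = g₂} {e′ = e₂} {r = p} E₁ (Edge.length>0 E₂) s
  ... | inj₁ h = inj₁ h
  ... | inj₂ h = inj₂ (inj₁ h)
  from p (inj₂ (inj₁ s)) with Segment⇒HalfOpen {g′ = g₃} {e′ = e₃} {r = p} E₂ (Edge.length>0 E₃) s
  ... | inj₁ h = inj₂ (inj₁ h)
  ... | inj₂ h = inj₂ (inj₂ h)
  from p (inj₂ (inj₂ s)) with Segment⇒HalfOpen {g′ = g₁} {e′ = e₁} {r = p} E₃ (Edge.length>0 E₁) s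
  ... | inj₁ h = inj₂ (inj₂ h)
  ... | inj₂ h = inj₁ h

module _ where
  open Data.Integer using (_*_; _+_; _-_; -_; _<_; _≤_; ∣_∣)

  -- Folding the half parallelogram onto the triangle

  i<j⇒0<j-i : ∀ {i j} → i < j → 0ℤ < j - i
  i<j⇒0<j-i {i} {j} i<j = subst (_< j - i) (ℤ.+-inverseʳ i) (ℤ.+-monoˡ-< (- i) i<j)

  0<j-i⇒i<j : ∀ {i j} → 0ℤ < j - i → i < j
  0<j-i⇒i<j {i} {j} 0<j-i = subst₂ _<_ (ℤ.+-identityˡ i) (cancel j i) (ℤ.+-monoˡ-< i 0<j-i)
    where
    cancel : ∀ j i → j - i + i ≡ j
    cancel = solve-∀ ℤ-ring

  0<i+j : ∀ {i j} → 0ℤ < i → 0ℤ < j → 0ℤ < i + j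
  0<i+j = ℤ.+-mono-<

  0<i*j : ∀ {i j} → 0ℤ < i → 0ℤ < j → 0ℤ < i * j
  0<i*j {i} {j} 0<i 0<j = subst (_< i * j) (ℤ.*-zeroʳ i) (ℤ.*-monoˡ-<-pos i {{ℤ.positive 0<i}} 0<j)

  0<i*j⇒0<j : ∀ {i j} → 0ℤ < i → 0ℤ < i * j → 0ℤ < j
  0<i*j⇒0<j {i} {j} 0<i 0<ij = ℤ.*-cancelˡ-<-nonNeg i {{ℤ.nonNegative (ℤ.<⇒≤ 0<i)}} (subst (_< i * j) (sym (ℤ.*-zeroʳ i)) 0<ij)

  ¬0<i<1 : ∀ {i} → 0ℤ < i → 0ℤ < 1ℤ - i → ⊥
  ¬0<i<1 {i} 0<i 0<1-i = ℤ.<⇒≱ 0<i (ℤ.i<j⇒i≤pred[j] {i} {1ℤ} (0<j-i⇒i<j 0<1-i))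

  2i≢1 : ∀ i → + 2 * i ≢ 1ℤ
  2i≢1 (+ zero) ()
  2i≢1 (+ suc n) eq = ℕ.1+n≢0 (ℕ.suc-injective (trans (cong suc (sym (ℕ.+-suc n (n ℕ.+ 0)))) (ℤ.+-injective eq)))
  2i≢1 -[1+ n ] ()

  no-multiple-between : ∀ {h y} k → 0ℤ < h → 0ℤ < y → 0ℤ < h - y → y ≢ h * k
  no-multiple-between {h} k 0<h 0<y 0<h-y refl =
    ¬0<i<1 (0<i*j⇒0<j 0<h 0<y) (0<i*j⇒0<j 0<h (subst (0ℤ <_) (factor h k) 0<h-y))
    where
    factor : ∀ h k → h - h * k ≡ h * (1ℤ - k)
    factor = solve-∀ ℤ-ring

  -- For the vertices (0 , 0), (3 , 0), (x , h), the barycentric coordinates of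
  -- (s , y) are below, offset and 3y, up to the common factor 3h.
  module Strip (x h : ℤ) where

    offset below : Lattice → ℤ
    offset (s , y) = s * h - x * y
    below (s , y) = + 3 * h - (s * h - x * y) - + 3 * y

    -- The point reflection in the centre of the parallelogram, which is the midpoint of the
    -- hypotenuse.
    reflect : Lattice → Lattice
    reflect (s , y) = + 3 + x - s , h - y

    -- The condition `0ℤ < h - y - y` cuts the open parallelogram at half its height; the two
    -- conditions on `offset` are its slanted sides.
    InTriangle InHalfStrip : Lattice → Set
    InTriangle  z@(s , y) = 0ℤ < y × 0ℤ < offset z × 0ℤ < below z
    InHalfStrip z@(s , y) = 0ℤ < y × 0ℤ < h - y - y × 0ℤ < offset z × 0ℤ < + 3 * h - offset z

    fold : Lattice → Lattice
    fold z with 0ℤ ℤ.<? below z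
    ... | yes _ = z
    ... | no  _ = reflect z

    fold-below : ∀ {z} → 0ℤ < below z → fold z ≡ z
    fold-below {z} 0<b with 0ℤ ℤ.<? below z
    ... | yes _   = refl
    ... | no  0≮b = contradiction 0<b 0≮b

    fold-above : ∀ {z} → ¬ 0ℤ < below z → fold z ≡ reflect z
    fold-above {z} 0≮b with 0ℤ ℤ.<? below z
    ... | yes 0<b = contradiction 0<b 0≮b
    ... | no  _   = refl

    reflect-involutive : ∀ z → reflect (reflect z) ≡ z
    reflect-involutive (s , y) = cong₂ _,_ (eqs x s) (eqy h y)
      where
      eqs : ∀ x s → + 3 + x - (+ 3 + x - s) ≡ s
      eqs = solve-∀ ℤ-ring
      eqy : ∀ h y → h - (h - y) ≡ y
      eqy = solve-∀ ℤ-ring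

    -- `below` is affine and vanishes at the centre of the reflection, hence is odd under it.
    below-reflect : ∀ z → below (reflect z) ≡ - below z
    below-reflect (s , y) = eq x h s y
      where
      eq : ∀ x h s y → + 3 * h - ((+ 3 + x - s) * h - x * (h - y)) - + 3 * (h - y)
        ≡ - (+ 3 * h - (s * h - x * y) - + 3 * y)
      eq = solve-∀ ℤ-ring

    offset-reflect : ∀ z → offset (reflect z) ≡ + 3 * h - offset z
    offset-reflect (s , y) = eq x h s y
      where
      eq : ∀ x h s y → (+ 3 + x - s) * h - x * (h - y) ≡ + 3 * h - (s * h - x * y)
      eq = solve-∀ ℤ-ring

    0<h-y : ∀ {y} → 0ℤ < y → 0ℤ < h - y - y → 0ℤ < h - y
    0<h-y {y} 0<y 0<h-2y = subst (0ℤ <_) (eq h y) (0<i+j 0<h-2y 0<y)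
      where
      eq : ∀ h y → h - y - y + y ≡ h - y
      eq = solve-∀ ℤ-ring

    module _ (off-hypotenuse : ∀ s y → 0ℤ < y → 0ℤ < h - y → below (s , y) ≢ 0ℤ) where

      -- Reflection brings a point from beyond the hypotenuse into the triangle. A point on the
      -- hypotenuse would stay on it, which `off-hypotenuse` excludes.
      fold-InTriangle : ∀ z → InHalfStrip z → InTriangle (fold z)
      fold-InTriangle z@(s , y) (0<y , 0<h-2y , 0<o , 0<3h-o) = by-cases (0ℤ ℤ.<? below z)
        where
        by-cases : Dec (0ℤ < below z) → InTriangle (fold z)
        by-cases (yes 0<b) = subst InTriangle (sym (fold-below 0<b)) (0<y , 0<o , 0<b)
        by-cases (no 0≮b) = subst InTriangle (sym (fold-above 0≮b))
          ( 0<h-y 0<y 0<h-2y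
          , subst (0ℤ <_) (sym (offset-reflect z)) 0<3h-o
          , subst (0ℤ <_) (sym (below-reflect z)) (ℤ.neg-mono-<
              (ℤ.≤∧≢⇒< (ℤ.≮⇒≥ 0≮b) (off-hypotenuse s y 0<y (0<h-y 0<y 0<h-2y)))))

      -- Unreflected points stay below half the height and reflected ones end above it, so a
      -- coincidence between the two cases is impossible.
      fold-injective : ∀ {z z′} → InHalfStrip z → InHalfStrip z′ → fold z ≡ fold z′ → z ≡ z′
      fold-injective {z} {z′} H H′ eq = by-cases (0ℤ ℤ.<? below z) (0ℤ ℤ.<? below z′)
        where
        mixed : ∀ {z z′} → InHalfStrip z → InHalfStrip z′ → z ≢ reflect z′
        mixed {_ , _} {s′ , y′} (_ , 0<h-2y , _) (_ , 0<h-2y′ , _) refl =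
          ℤ.<-irrefl refl (subst (0ℤ <_) (cancel h y′) (0<i+j 0<h-2y 0<h-2y′))
          where
          cancel : ∀ h y → h - (h - y) - (h - y) + (h - y - y) ≡ 0ℤ
          cancel = solve-∀ ℤ-ring
        by-cases : Dec (0ℤ < below z) → Dec (0ℤ < below z′) → z ≡ z′
        by-cases (yes b) (yes b′) = trans (sym (fold-below b)) (trans eq (fold-below b′))
        by-cases (yes b) (no ¬b′) = contradiction (trans (sym (fold-below b)) (trans eq (fold-above ¬b′))) (mixed H H′)
        by-cases (no ¬b) (yes b′) = contradiction (trans (sym (fold-below b′)) (trans (sym eq) (fold-above ¬b))) (mixed H′ H)
        by-cases (no ¬b) (no ¬b′) = trans (sym (reflect-involutive z))
          (trans (cong reflect (trans (sym (fold-above ¬b)) (trans eq (fold-above ¬b′)))) (reflect-involutive z′))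

    -- The row decides the preimage: the point itself in the lower half, its reflection in the upper
    -- half. Oddness of `h` rules out a row at exactly half the height.
    fold-surjective : (∀ y → y + y ≢ h) → ∀ z → InTriangle z → ∃[ z′ ] InHalfStrip z′ × z ≡ fold z′
    fold-surjective odd z@(s , y) (0<y , 0<o , 0<b) = by-cases (ℤ.<-cmp (y + y) h)
      where
      0<3y : 0ℤ < + 3 * y
      0<3y = 0<i*j {+ 3} (+<+ (s≤s z≤n)) 0<y
      0<3h-o : 0ℤ < + 3 * h - offset z
      0<3h-o = subst (0ℤ <_) (eq (+ 3 * h - offset z) (+ 3 * y)) (0<i+j 0<b 0<3y)
        where
        eq : ∀ a b → a - b + b ≡ a
        eq = solve-∀ ℤ-ring
      -- The values of `offset` and `below` add up to `3 (h - y)`.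
      0<h-y′ : 0ℤ < h - y
      0<h-y′ = 0<i*j⇒0<j {+ 3} (+<+ (s≤s z≤n)) (subst (0ℤ <_) (eq h (offset z) y) (0<i+j 0<o 0<b))
        where
        eq : ∀ h o y → o + (+ 3 * h - o - + 3 * y) ≡ + 3 * (h - y)
        eq = solve-∀ ℤ-ring
      by-cases : _ → ∃[ z′ ] InHalfStrip z′ × z ≡ fold z′
      by-cases (tri< 2y<h _ _) = z , (0<y , subst (0ℤ <_) (eq h y) (i<j⇒0<j-i 2y<h) , 0<o , 0<3h-o) , sym (fold-below 0<b)
        where
        eq : ∀ h y → h - (y + y) ≡ h - y - y
        eq = solve-∀ ℤ-ring
      by-cases (tri≈ _ 2y≡h _) = contradiction 2y≡h (odd y)
      by-cases (tri> _ _ h<2y) = reflect z ,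
        ( 0<h-y′ , subst (0ℤ <_) (eq h y) (i<j⇒0<j-i h<2y)
        , subst (0ℤ <_) (sym (offset-reflect z)) 0<3h-o
        , subst (0ℤ <_) (trans (eq′ h (offset z)) (cong (λ t → + 3 * h - t) (sym (offset-reflect z)))) 0<o)
        , sym (trans (fold-above λ 0<b′ → ℤ.<-asym 0<b (subst (_< 0ℤ) (trans (cong -_ (below-reflect z)) (ℤ.neg-involutive (below z))) (ℤ.neg-mono-< 0<b′)))
            (reflect-involutive z))
        where
        eq : ∀ h y → y + y - h ≡ h - (h - y) - (h - y)
        eq = solve-∀ ℤ-ring
        eq′ : ∀ h o → o ≡ + 3 * h - (+ 3 * h - o)
        eq′ = solve-∀ ℤ-ring

  -- Three lattice points in each row

  module Rows (x : ℤ) (m : ℕ) where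
    open Algebra.Properties.Group (AbelianGroup.group ℤ.+-0-abelianGroup) using (∙-cancelˡ)

    H : ℕ
    H = suc (m ℕ.+ m)
    h : ℤ
    h = + H
    open Strip x h public

    row : Fin m → ℤ
    row i = + suc (toℕ i)

    floor : ℤ → ℤ
    floor y = (x * y) ℤ./ℕ H

    rest : ℤ → ℤ
    rest y = + ((x * y) ℤ.%ℕ H)

    -- Row `y` of the parallelogram is the open interval of length 3 starting at `x y / h`. If this
    -- start is not an integer, the interval contains exactly the three integers after its floor.
    cell : Fin m × Fin 3 → Lattice
    cell (i , j) = floor (row i) + + suc (toℕ j) , row i

    floor-rest : ∀ y → x * y ≡ rest y + floor y * h
    floor-rest y = ℤ.a≡a%ℕn+[a/ℕn]*n (x * y) H

    rest<h : ∀ y → 0ℤ < h - rest y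
    rest<h y = i<j⇒0<j-i (+<+ (ℤ.n%ℕd<d (x * y) H))

    offset-floor : ∀ t y → offset (floor y + t , y) ≡ t * h - rest y
    offset-floor t y = trans (cong (λ w → (floor y + t) * h - w) (floor-rest y)) (eq (floor y) t h (rest y))
      where
      eq : ∀ q t h r → (q + t) * h - (r + q * h) ≡ t * h - r
      eq = solve-∀ ℤ-ring

    0<h : 0ℤ < h
    0<h = +<+ (s≤s z≤n)

    cell-injective : ∀ {a b} → cell a ≡ cell b → a ≡ b
    cell-injective {i , j} {i′ , j′} eq with Fin.toℕ-injective {i = i} {i′} (ℕ.suc-injective (ℤ.+-injective (cong proj₂ eq)))
    ... | refl = cong (i ,_) (Fin.toℕ-injective (ℕ.suc-injective (ℤ.+-injective
          (∙-cancelˡ (floor (row i)) (+ suc (toℕ j)) (+ suc (toℕ j′)) (cong proj₁ eq)))))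

    below-middle : ∀ i → 0ℤ < h - row i - row i
    below-middle i = subst (0ℤ <_) (eq h (row i))
      (i<j⇒0<j-i (+<+ (s≤s (ℕ.+-mono-≤ (Fin.toℕ<n i) (Fin.toℕ<n i)))))
      where
      eq : ∀ h y → h - (y + y) ≡ h - y - y
      eq = solve-∀ ℤ-ring

    cell-InHalfStrip : (∀ s y → 0ℤ < y → 0ℤ < h - y → offset (s , y) ≢ 0ℤ) → ∀ a → InHalfStrip (cell a)
    cell-InHalfStrip off-leg (i , j) = 0<y , below-middle i ,
        subst (0ℤ <_) (sym (offset-floor (+ suc (toℕ j)) y)) 0<o ,
        subst (λ o → 0ℤ < + 3 * h - o) (sym (offset-floor (+ suc (toℕ j)) y)) 0<3h-o
      where
      y = row i
      0<y : 0ℤ < y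
      0<y = +<+ (s≤s z≤n)
      -- A zero remainder would put the lattice point `(floor y , y)` on the leg. A positive one
      -- keeps the third column strictly inside the opposite side.
      r≢0 : 0 ≢ (x * y) ℤ.%ℕ H
      r≢0 eq = off-leg (floor y) y 0<y (0<h-y 0<y (below-middle i))
        (trans (cong (λ w → floor y * h - w) (trans (floor-rest y) (cong (λ r → + r + floor y * h) (sym eq))))
          (cancel (floor y * h)))
        where
        cancel : ∀ w → w - (0ℤ + w) ≡ 0ℤ
        cancel = solve-∀ ℤ-ring
      0<r : 0ℤ < rest y
      0<r = +<+ (ℕ.≤∧≢⇒< z≤n r≢0)
      0≤jh : 0ℤ ≤ + toℕ j * h
      0≤jh = ℤ.*-monoʳ-≤-nonNeg h {0ℤ} {+ toℕ j} (+≤+ z≤n)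
      0<o : 0ℤ < + suc (toℕ j) * h - rest y
      0<o = subst (0ℤ <_) (eq (+ toℕ j) h (rest y)) (ℤ.+-mono-≤-< 0≤jh (rest<h y))
        where
        eq : ∀ t h r → t * h + (h - r) ≡ (1ℤ + t) * h - r
        eq = solve-∀ ℤ-ring
      0≤2-j : 0ℤ ≤ + 2 - + toℕ j
      0≤2-j = ℤ.i≤j⇒0≤j-i (+≤+ (ℕ.≤-pred (Fin.toℕ<n j)))
      0<3h-o : 0ℤ < + 3 * h - (+ suc (toℕ j) * h - rest y)
      0<3h-o = subst (0ℤ <_) (eq (+ toℕ j) h (rest y))
        (ℤ.+-mono-≤-< (ℤ.*-monoʳ-≤-nonNeg h {0ℤ} {+ 2 - + toℕ j} 0≤2-j) 0<r)
        where
        eq : ∀ t h r → (+ 2 - t) * h + r ≡ + 3 * h - ((1ℤ + t) * h - r)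
        eq = solve-∀ ℤ-ring

    cell-surjective : ∀ z → InHalfStrip z → ∃[ a ] z ≡ cell a
    cell-surjective (s , -[1+ _ ]) (() , _)
    cell-surjective (s , + zero) (+<+ () , _)
    cell-surjective (s , y@(+ suc n)) (0<y , 0<h-2y , 0<o , 0<3h-o) = (i , j) , cong₂ _,_ s≡ (sym row-i)
      where
      n<m : n ℕ.< m
      n<m = ℕ.≰⇒> λ m≤n → ℕ.<⇒≱ (ℤ.drop‿+<+ (0<j-i⇒i<j {y + y} {h} (subst (0ℤ <_) (eq h y) 0<h-2y)))
        (ℕ.≤-trans (s≤s (ℕ.+-mono-≤ m≤n m≤n)) (s≤s (ℕ.+-monoʳ-≤ n (ℕ.n≤1+n n))))
        where
        eq : ∀ h y → h - y - y ≡ h - (y + y)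
        eq = solve-∀ ℤ-ring
      i = fromℕ< n<m
      row-i : row i ≡ y
      row-i = cong (λ k → + suc k) (Fin.toℕ-fromℕ< n<m)
      t = s - floor y
      s≡q+t : s ≡ floor y + t
      s≡q+t = eq s (floor y)
        where
        eq : ∀ s q → s ≡ q + (s - q)
        eq = solve-∀ ℤ-ring
      offset≡ : offset (s , y) ≡ t * h - rest y
      offset≡ = trans (cong (λ s → offset (s , y)) s≡q+t) (offset-floor t y)
      0<t : 0ℤ < t
      0<t = 0<i*j⇒0<j 0<h (subst (0ℤ <_) (eq (rest y) t h)
        (ℤ.+-mono-<-≤ (subst (0ℤ <_) offset≡ 0<o) (+≤+ z≤n)))
        where
        eq : ∀ r t h → t * h - r + r ≡ h * t
        eq = solve-∀ ℤ-ring
      -- The bound `t h < 3h + r` is no multiple of `h`; adding `h - r > 0` rounds it up to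
      -- `t h < 4h`.
      t<4 : 0ℤ < + 4 - t
      t<4 = 0<i*j⇒0<j 0<h (subst (0ℤ <_) (eq t h (rest y))
        (0<i+j (subst (λ o → 0ℤ < + 3 * h - o) offset≡ 0<3h-o) (rest<h y)))
        where
        eq : ∀ t h r → + 3 * h - (t * h - r) + (h - r) ≡ h * (+ 4 - t)
        eq = solve-∀ ℤ-ring
      column : ∀ t → 0ℤ < t → t < + 4 → ∃[ j ] t ≡ + suc (toℕ {3} j)
      column (+ zero)  (+<+ ()) _
      column -[1+ _ ]  () _
      column (+ suc k) _ (+<+ (s≤s k<3)) = fromℕ< k<3 , cong (λ k → + suc k) (sym (Fin.toℕ-fromℕ< k<3))
      c = column t 0<t (0<j-i⇒i<j t<4)
      j = proj₁ c
      s≡ : s ≡ floor (row i) + + suc (toℕ j)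
      s≡ = trans s≡q+t (cong₂ (λ y t → floor y + t) (sym row-i) (proj₂ c))

    odd : ∀ y → y + y ≢ h
    odd y eq = 2i≢1 (y - + m) (trans (rearrange y (+ m)) (trans (cong (λ w → w - + 2 * + m) eq) (cancel (+ m))))
      where
      rearrange : ∀ y m → + 2 * (y - m) ≡ y + y - + 2 * m
      rearrange = solve-∀ ℤ-ring
      cancel : ∀ m → 1ℤ + (m + m) - + 2 * m ≡ 1ℤ
      cancel = solve-∀ ℤ-ring

    -- A bijection `φ` of the lattice carries the count from the normal form to a triangle in
    -- arbitrary position; `S` will be the set of its interior points.
    count : (φ : Lattice → Lattice) → (∀ {z z′} → φ z ≡ φ z′ → z ≡ z′) → (∀ p → ∃[ z ] p ≡ φ z) →
      (∀ s y → 0ℤ < y → 0ℤ < h - y → offset (s , y) ≢ 0ℤ) →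
      (∀ s y → 0ℤ < y → 0ℤ < h - y → below (s , y) ≢ 0ℤ) →
      {S : Lattice → Set} → (∀ z → S (φ z) ⇔ InTriangle z) → HasExactly (m ℕ.* 3) S
    count φ φ-injective φ-surjective off-leg off-hypotenuse {S} S⇔ =
      subst (λ n → HasExactly n S) size
        (HasExactly-cong (λ p → mk⇔ (to p) (from p))
          (HasExactly-image (Unique.cartesianProduct⁺ (Unique.allFin⁺ m) (Unique.allFin⁺ 3))
            (λ (i , j) → ∈-cartesianProduct⁺ (∈-allFin i) (∈-allFin j)) f f-injective))
      where
      f : Fin m × Fin 3 → Lattice
      f a = φ (fold (cell a))
      in-strip = cell-InHalfStrip off-leg
      f-injective : ∀ {a b} → f a ≡ f b → a ≡ b
      f-injective {a} {b} eq = cell-injective (fold-injective off-hypotenuse (in-strip a) (in-strip b) (φ-injective eq))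
      to : ∀ p → ∃[ a ] p ≡ f a → S p
      to _ (a , refl) = Equivalence.from (S⇔ (fold (cell a))) (fold-InTriangle off-hypotenuse (cell a) (in-strip a))
      from : ∀ p → S p → ∃[ a ] p ≡ f a
      from p Sp with φ-surjective p
      ... | z , refl with fold-surjective odd z (Equivalence.to (S⇔ z) Sp)
      ... | z′ , H′ , z≡ with cell-surjective z′ H′
      ... | a , z′≡ = a , cong φ (trans z≡ (cong fold z′≡))
      size : length (cartesianProduct (allFin m) (allFin 3)) ≡ m ℕ.* 3
      size = trans (length-cartesianProduct (allFin m) (allFin 3)) (cong (ℕ._* 3) (length-tabulate {n = m} (λ i → i)))

-- Primitive vectors and lattice bases

module _ where
  open Data.Integer using (_*_; _+_; _-_; -_; _<_; _≤_; ∣_∣)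

  -- Since `x` is prime to `h`, the equation `s h = x y` would make `y` a multiple of `h`, strictly
  -- between 0 and `h`.
  Primitive⇒no-multiple : ∀ {x h} s y → Primitive (x , h) → 0ℤ < h → 0ℤ < y → 0ℤ < h - y → s * h ≢ x * y
  Primitive⇒no-multiple {x} {h} s y (u , v , prim) 0<h 0<y 0<h-y sh≡xy =
    no-multiple-between (u * s + v * y) 0<h 0<y 0<h-y (begin
      y                         ≡⟨ sym (ℤ.*-identityʳ y) ⟩
      y * 1ℤ                    ≡⟨ cong (y *_) (sym prim) ⟩
      y * (u * x + v * h)       ≡⟨ expand x h y u v ⟩
      u * (x * y) + h * (v * y) ≡⟨ cong (λ w → u * w + h * (v * y)) (sym sh≡xy) ⟩
      u * (s * h) + h * (v * y) ≡⟨ collect s h y u v ⟩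
      h * (u * s + v * y)       ∎)
    where
    open ≡-Reasoning
    expand : ∀ x h y u v → y * (u * x + v * h) ≡ u * (x * y) + h * (v * y)
    expand = solve-∀ ℤ-ring
    collect : ∀ s h y u v → u * (s * h) + h * (v * y) ≡ h * (u * s + v * y)
    collect = solve-∀ ℤ-ring

  parity : ∀ n → ∃[ m ] (n ≡ m ℕ.+ m ⊎ n ≡ suc (m ℕ.+ m))
  parity zero = 0 , inj₁ refl
  parity (suc n) with parity n
  ... | m , inj₁ refl = m , inj₂ refl
  ... | m , inj₂ refl = suc m , inj₁ (cong suc (sym (ℕ.+-suc m m)))

  parityℤ : ∀ i → ∃[ j ] (i ≡ + 2 * j ⊎ i ≡ + 2 * j + 1ℤ)
  parityℤ i with i ℤ.%ℕ 2 | ℤ.n%ℕd<d i 2 | ℤ.a≡a%ℕn+[a/ℕn]*n i 2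
  ... | 0 | _ | eq = i ℤ./ℕ 2 , inj₁ (trans eq (rearrange (i ℤ./ℕ 2)))
    where
    rearrange : ∀ q → 0ℤ + q * + 2 ≡ + 2 * q
    rearrange = solve-∀ ℤ-ring
  ... | 1 | _ | eq = i ℤ./ℕ 2 , inj₂ (trans eq (rearrange (i ℤ./ℕ 2)))
    where
    rearrange : ∀ q → 1ℤ + q * + 2 ≡ + 2 * q + 1ℤ
    rearrange = solve-∀ ℤ-ring
  ... | suc (suc _) | s≤s (s≤s ()) | _

  -- One of `x` and `x - 3` is even and would share the factor 2 with an even height.
  Primitive⇒¬even : ∀ x m → Primitive (x , + (m ℕ.+ m)) → Primitive (x - + 3 , + (m ℕ.+ m)) → ⊥
  Primitive⇒¬even x m (u , v , prim) (u′ , v′ , prim′) with parityℤ x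
  ... | k , inj₁ refl = 2i≢1 (u * k + v * + m) (trans (eq u k v (+ m)) prim)
    where
    eq : ∀ u k v m → + 2 * (u * k + v * m) ≡ u * (+ 2 * k) + v * (m + m)
    eq = solve-∀ ℤ-ring
  ... | k , inj₂ refl = 2i≢1 (u′ * (k - 1ℤ) + v′ * + m) (trans (eq u′ k v′ (+ m)) prim′)
    where
    eq : ∀ u k v m → + 2 * (u * (k - 1ℤ) + v * m) ≡ u * (+ 2 * k + 1ℤ - + 3) + v * (m + m)
    eq = solve-∀ ℤ-ring

  -- Determinant −1 is allowed so that the height h of the third vertex can always be positive.
  module Frame (A e f : Lattice) (σ : ℤ) (σσ≡1 : σ * σ ≡ 1ℤ)
    (det : proj₁ e * proj₂ f - proj₂ e * proj₁ f ≡ σ) where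

    private
      ax = proj₁ A ; ay = proj₂ A
      ex = proj₁ e ; ey = proj₂ e
      fx = proj₁ f ; fy = proj₂ f

    φ : Lattice → Lattice
    φ (s , y) = ax + s * ex + y * fx , ay + s * ey + y * fy

    -- Cramer's rule in the basis `e`, `f`: as `σ` is its own inverse, multiplying by it divides by
    -- the determinant.
    ψ : Lattice → Lattice
    ψ (px , py) = σ * ((px - ax) * fy - (py - ay) * fx) , σ * (ex * (py - ay) - ey * (px - ax))

    σ-cancel : ∀ i → σ * (ex * fy - ey * fx) * i ≡ i
    σ-cancel i = trans (cong (λ d → σ * d * i) det) (trans (cong (_* i) σσ≡1) (ℤ.*-identityˡ i))

    φψ : ∀ p → p ≡ φ (ψ p)
    φψ (px , py) = cong₂ _,_
      (trans (split px ax) (trans (cong (λ t → ax + t) (sym (σ-cancel (px - ax)))) (eqx px py ax ay ex ey fx fy σ)))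
      (trans (split py ay) (trans (cong (λ t → ay + t) (sym (σ-cancel (py - ay)))) (eqy px py ax ay ex ey fx fy σ)))
      where
      split : ∀ p a → p ≡ a + (p - a)
      split = solve-∀ ℤ-ring
      eqx : ∀ px py ax ay ex ey fx fy σ → ax + σ * (ex * fy - ey * fx) * (px - ax)
        ≡ ax + σ * ((px - ax) * fy - (py - ay) * fx) * ex + σ * (ex * (py - ay) - ey * (px - ax)) * fx
      eqx = solve-∀ ℤ-ring
      eqy : ∀ px py ax ay ex ey fx fy σ → ay + σ * (ex * fy - ey * fx) * (py - ay)
        ≡ ay + σ * ((px - ax) * fy - (py - ay) * fx) * ey + σ * (ex * (py - ay) - ey * (px - ax)) * fy
      eqy = solve-∀ ℤ-ring

    ψφ : ∀ z → ψ (φ z) ≡ z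
    ψφ (s , y) = cong₂ _,_
      (trans (eqs s y ax ay ex ey fx fy σ) (σ-cancel s)) (trans (eqy s y ax ay ex ey fx fy σ) (σ-cancel y))
      where
      eqs : ∀ s y ax ay ex ey fx fy σ →
        σ * ((ax + s * ex + y * fx - ax) * fy - (ay + s * ey + y * fy - ay) * fx) ≡ σ * (ex * fy - ey * fx) * s
      eqs = solve-∀ ℤ-ring
      eqy : ∀ s y ax ay ex ey fx fy σ →
        σ * (ex * (ay + s * ey + y * fy - ay) - ey * (ax + s * ex + y * fx - ax)) ≡ σ * (ex * fy - ey * fx) * y
      eqy = solve-∀ ℤ-ring

    φ-injective : ∀ {z z′} → φ z ≡ φ z′ → z ≡ z′
    φ-injective {z} {z′} eq = trans (sym (ψφ z)) (trans (cong ψ eq) (ψφ z′))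

    orient-φ : ∀ P Q R → orient (φ P) (φ Q) (φ R) ≡ σ * orient P Q R
    orient-φ (px , py) (qx , qy) (rx , ry) =
      trans (eq px py qx qy rx ry ax ay ex ey fx fy) (cong (_* orient (px , py) (qx , qy) (rx , ry)) det)
      where
      eq : ∀ px py qx qy rx ry ax ay ex ey fx fy →
        (ax + qx * ex + qy * fx - (ax + px * ex + py * fx)) * (ay + rx * ey + ry * fy - (ay + px * ey + py * fy))
        - (ay + qx * ey + qy * fy - (ay + px * ey + py * fy)) * (ax + rx * ex + ry * fx - (ax + px * ex + py * fx))
        ≡ (ex * fy - ey * fx) * ((qx - px) * (ry - py) - (qy - py) * (rx - px))
      eq = solve-∀ ℤ-ring

    -- The sign `σ` cancels in a product of two determinants, so the conditions of `Inside` survive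
    -- a change of orientation.
    orient*orient-φ : ∀ P Q R P′ Q′ R′ →
      orient (φ P) (φ Q) (φ R) * orient (φ P′) (φ Q′) (φ R′) ≡ orient P Q R * orient P′ Q′ R′
    orient*orient-φ P Q R P′ Q′ R′ = trans (cong₂ _*_ (orient-φ P Q R) (orient-φ P′ Q′ R′))
      (trans (eq σ (orient P Q R) (orient P′ Q′ R′))
        (trans (cong (_* (orient P Q R * orient P′ Q′ R′)) σσ≡1) (ℤ.*-identityˡ _)))
      where
      eq : ∀ σ a b → σ * a * (σ * b) ≡ σ * σ * (a * b)
      eq = solve-∀ ℤ-ring

  module InFrame (T : LatticeTriangle) (e f : Lattice) (σ : ℤ) (σσ≡1 : σ * σ ≡ 1ℤ)
    (det : proj₁ e * proj₂ f - proj₂ e * proj₁ f ≡ σ) (x : ℤ) (m : ℕ) where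
    open LatticeTriangle T
    open Frame A e f σ σσ≡1 det
    open Rows x m

    module _ (B≡ : B ≡ φ (+ 3 , 0ℤ)) (C≡ : C ≡ φ (x , h)) where

      A≡ : A ≡ φ (0ℤ , 0ℤ)
      A≡ = cong₂ _,_ (eq (proj₁ A) (proj₁ e) (proj₁ f)) (eq (proj₂ A) (proj₂ e) (proj₂ f))
        where
        eq : ∀ a e f → a ≡ a + 0ℤ * e + 0ℤ * f
        eq = solve-∀ ℤ-ring

      private
        O₀ I₀ J₀ : Lattice
        O₀ = 0ℤ , 0ℤ
        I₀ = + 3 , 0ℤ
        J₀ = x , h

      0<9h : 0ℤ < + 9 * h
      0<9h = 0<i*j {+ 9} (+<+ (s≤s z≤n)) 0<h

      -- In these coordinates the weights of `A`, `B`, `C` are the positive number `3h` times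
      -- `below`, `offset` and `3y`.
      interior⇔ : ∀ z → InteriorPoint T (φ z) ⇔ InTriangle z
      interior⇔ z@(s , y) = ⇔.trans (InteriorPoint⇔Inside T (φ z)) (mk⇔
        (λ (a , b , c) →
            0<i*j⇒0<j 0<9h (subst (0ℤ <_) (trans weight-C (eq-C s y x h)) c)
          , 0<i*j⇒0<j 0<3h (subst (0ℤ <_) (trans weight-B (eq-B s y x h)) b)
          , 0<i*j⇒0<j 0<3h (subst (0ℤ <_) (trans weight-A (eq-A s y x h)) a))
        (λ (0<y , 0<o , 0<b) →
            subst (0ℤ <_) (sym (trans weight-A (eq-A s y x h))) (0<i*j 0<3h 0<b)
          , subst (0ℤ <_) (sym (trans weight-B (eq-B s y x h))) (0<i*j 0<3h 0<o)
          , subst (0ℤ <_) (sym (trans weight-C (eq-C s y x h))) (0<i*j 0<9h 0<y)))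
        where
        0<3h : 0ℤ < + 3 * h
        0<3h = 0<i*j {+ 3} (+<+ (s≤s z≤n)) 0<h
        area≡ : area T ≡ orient (φ O₀) (φ I₀) (φ J₀)
        area≡ = trans (cong (λ a → orient a B C) A≡) (cong₂ (orient (φ O₀)) B≡ C≡)
        weight-A : area T * orient (φ z) B C ≡ orient O₀ I₀ J₀ * orient z I₀ J₀
        weight-A = trans (cong₂ _*_ area≡ (cong₂ (orient (φ z)) B≡ C≡)) (orient*orient-φ O₀ I₀ J₀ z I₀ J₀)
        weight-B : area T * orient (φ z) C A ≡ orient O₀ I₀ J₀ * orient z J₀ O₀
        weight-B = trans (cong₂ _*_ area≡ (cong₂ (orient (φ z)) C≡ A≡)) (orient*orient-φ O₀ I₀ J₀ z J₀ O₀)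
        weight-C : area T * orient (φ z) A B ≡ orient O₀ I₀ J₀ * orient z O₀ I₀
        weight-C = trans (cong₂ _*_ area≡ (cong₂ (orient (φ z)) A≡ B≡)) (orient*orient-φ O₀ I₀ J₀ z O₀ I₀)
        eq-A : ∀ s y x h → ((+ 3 - 0ℤ) * (h - 0ℤ) - (0ℤ - 0ℤ) * (x - 0ℤ)) * ((+ 3 - s) * (h - y) - (0ℤ - y) * (x - s))
          ≡ + 3 * h * (+ 3 * h - (s * h - x * y) - + 3 * y)
        eq-A = solve-∀ ℤ-ring
        eq-B : ∀ s y x h → ((+ 3 - 0ℤ) * (h - 0ℤ) - (0ℤ - 0ℤ) * (x - 0ℤ)) * ((x - s) * (0ℤ - y) - (h - y) * (0ℤ - s))
          ≡ + 3 * h * (s * h - x * y)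
        eq-B = solve-∀ ℤ-ring
        eq-C : ∀ s y x h → ((+ 3 - 0ℤ) * (h - 0ℤ) - (0ℤ - 0ℤ) * (x - 0ℤ)) * ((0ℤ - s) * (0ℤ - y) - (0ℤ - y) * (+ 3 - s))
          ≡ + 9 * h * y
        eq-C = solve-∀ ℤ-ring

      interior-count : Primitive (x , h) → Primitive (x - + 3 , h) → HasExactly (m ℕ.* 3) (InteriorPoint T)
      interior-count prim prim′ = count φ φ-injective (λ p → ψ p , φψ p) off-leg off-hypotenuse interior⇔
        where
        off-leg : ∀ s y → 0ℤ < y → 0ℤ < h - y → offset (s , y) ≢ 0ℤ
        off-leg s y 0<y 0<h-y o≡0 = Primitive⇒no-multiple s y prim 0<h 0<y 0<h-y (ℤ.i-j≡0⇒i≡j _ _ o≡0)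
        -- Translation by -3 moves the hypotenuse to the line through the origin in direction
        -- `(x - 3 , h)`.
        off-hypotenuse : ∀ s y → 0ℤ < y → 0ℤ < h - y → below (s , y) ≢ 0ℤ
        off-hypotenuse s y 0<y 0<h-y b≡0 = Primitive⇒no-multiple (s - + 3) y prim′ 0<h 0<y 0<h-y
          (ℤ.i-j≡0⇒i≡j _ _ (trans (eq s y x h) (cong -_ b≡0)))
          where
          eq : ∀ s y x h → (s - + 3) * h - (x - + 3) * y ≡ - (+ 3 * h - (s * h - x * y) - + 3 * y)
          eq = solve-∀ ℤ-ring

  -- A functional with value 1 on `s e + y f`, evaluated on `e` and on `f`, yields Bézout
  -- coefficients for `(s , y)`.
  Primitive-combination : ∀ {ex ey fx fy s y} → Primitive (s * ex + y * fx , s * ey + y * fy) → Primitive (s , y)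
  Primitive-combination {ex} {ey} {fx} {fy} {s} {y} (u , v , prim) =
    u * ex + v * ey , u * fx + v * fy , trans (eq ex ey fx fy s y u v) prim
    where
    eq : ∀ ex ey fx fy s y u v → (u * ex + v * ey) * s + (u * fx + v * fy) * y ≡ u * (s * ex + y * fx) + v * (s * ey + y * fy)
    eq = solve-∀ ℤ-ring

  Primitive-neg : ∀ {x y} → Primitive (- x , - y) → Primitive (x , y)
  Primitive-neg {x} {y} (u , v , prim) = - u , - v , trans (eq u v x y) prim
    where
    eq : ∀ u v x y → (- u) * x + (- v) * y ≡ u * (- x) + v * (- y)
    eq = solve-∀ ℤ-ring

-- Triangles with five boundary points

module _ where
  open Data.Integer using (_*_; _+_; _-_; -_; _<_; _≤_; ∣_∣)

  interior-multiple-of-3 : ∀ T {e₁ e₂ e₃} → let open LatticeTriangle T in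
    Edge A B 3 e₁ → Edge B C 1 e₂ → Edge C A 1 e₃ → ∃[ m ] HasExactly (m ℕ.* 3) (InteriorPoint T)
  interior-multiple-of-3 T {e@(ex , ey)} {e₂@(e₂x , e₂y)} {e₃@(e₃x , e₃y)} E₁ E₂ E₃ = by-parity (parity n)
    where
    open LatticeTriangle T
    ax = proj₁ A ; ay = proj₂ A
    dx = proj₁ C - ax ; dy = proj₂ C - ay
    u = proj₁ (Edge.isPrimitive E₁) ; v = proj₁ (proj₂ (Edge.isPrimitive E₁))
    prim = proj₂ (proj₂ (Edge.isPrimitive E₁))
    height = ex * dy - ey * dx
    σ = proj₁ (sign-split height)
    σσ≡1 = proj₁ (proj₂ (sign-split height))
    n = ∣ height ∣
    σn≡height : σ * + n ≡ height
    σn≡height = sym (proj₂ (proj₂ (sign-split height)))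
    x = u * dx + v * dy
    -- The Bézout coefficients of `e`, turned by a right angle, complete `e` to a lattice basis. The
    -- sign `σ` of the height makes the second coordinate of `C` equal to the natural number `n`.
    f : Lattice
    f = - (σ * v) , σ * u
    det-ef : ex * (σ * u) - ey * (- (σ * v)) ≡ σ
    det-ef = trans (eq ex ey σ u v) (trans (cong (σ *_) prim) (ℤ.*-identityʳ σ))
      where
      eq : ∀ ex ey σ u v → ex * (σ * u) - ey * (- (σ * v)) ≡ σ * (u * ex + v * ey)
      eq = solve-∀ ℤ-ring
    C≡ : C ≡ (ax + x * ex + + n * - (σ * v) , ay + x * ey + + n * (σ * u))
    C≡ = cong₂ _,_
      (begin
        proj₁ C                                     ≡⟨ split (proj₁ C) ax ⟩
        ax + 1ℤ * dx                                ≡⟨ cong (λ t → ax + t * dx) (sym prim) ⟩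
        ax + (u * ex + v * ey) * dx                 ≡⟨ eqx ax ex ey dx dy u v ⟩
        ax + x * ex - v * height                    ≡⟨ cong (λ t → ax + x * ex - v * t) (sym σn≡height) ⟩
        ax + x * ex - v * (σ * + n)                 ≡⟨ eqx′ (ax + x * ex) v σ (+ n) ⟩
        ax + x * ex + + n * - (σ * v)               ∎)
      (begin
        proj₂ C                                     ≡⟨ split (proj₂ C) ay ⟩
        ay + 1ℤ * dy                                ≡⟨ cong (λ t → ay + t * dy) (sym prim) ⟩
        ay + (u * ex + v * ey) * dy                 ≡⟨ eqy ay ex ey dx dy u v ⟩
        ay + x * ey + u * height                    ≡⟨ cong (λ t → ay + x * ey + u * t) (sym σn≡height) ⟩
        ay + x * ey + u * (σ * + n)                 ≡⟨ eqy′ (ay + x * ey) u σ (+ n) ⟩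
        ay + x * ey + + n * (σ * u)                 ∎)
      where
      open ≡-Reasoning
      split : ∀ c a → c ≡ a + 1ℤ * (c - a)
      split = solve-∀ ℤ-ring
      eqx : ∀ ax ex ey dx dy u v → ax + (u * ex + v * ey) * dx ≡ ax + (u * dx + v * dy) * ex - v * (ex * dy - ey * dx)
      eqx = solve-∀ ℤ-ring
      eqx′ : ∀ w v σ n → w - v * (σ * n) ≡ w + n * - (σ * v)
      eqx′ = solve-∀ ℤ-ring
      eqy : ∀ ay ex ey dx dy u v → ay + (u * ex + v * ey) * dy ≡ ay + (u * dx + v * dy) * ey + u * (ex * dy - ey * dx)
      eqy = solve-∀ ℤ-ring
      eqy′ : ∀ w u σ n → w + u * (σ * n) ≡ w + n * (σ * u)
      eqy′ = solve-∀ ℤ-ring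
    -- An edge of lattice length 1 equals its primitive direction, so `e₃` is `A - C` and `e₂` is
    -- `C - B`, treated one coordinate at a time.
    CA-direction : ∀ a c e p q → a ≡ c + 1ℤ * e → c ≡ a + p + q → e ≡ - (p + q)
    CA-direction a c e p q a≡ c≡ = trans (split e c) (trans (cong₂ _-_ (sym a≡) c≡) (eq a p q))
      where
      split : ∀ e c → e ≡ c + 1ℤ * e - c
      split = solve-∀ ℤ-ring
      eq : ∀ a p q → a - (a + p + q) ≡ - (p + q)
      eq = solve-∀ ℤ-ring
    BC-direction : ∀ a b c e₁ e₂ q → b ≡ a + + 3 * e₁ → c ≡ b + 1ℤ * e₂ → c ≡ a + x * e₁ + q → e₂ ≡ (x - + 3) * e₁ + q
    BC-direction a b c e₁ e₂ q refl c≡ c≡′ = trans (split e₂ a e₁)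
      (trans (cong (λ t → t - (a + + 3 * e₁)) (trans (sym c≡) c≡′)) (eq a x e₁ q))
      where
      split : ∀ e₂ a e₁ → e₂ ≡ a + + 3 * e₁ + 1ℤ * e₂ - (a + + 3 * e₁)
      split = solve-∀ ℤ-ring
      eq : ∀ a x e q → a + x * e + q - (a + + 3 * e) ≡ (x - + 3) * e + q
      eq = solve-∀ ℤ-ring
    primitive-AC : Primitive (x , + n)
    primitive-AC = Primitive-combination {ex} {ey} {proj₁ f} {proj₂ f} (Primitive-neg (subst Primitive
      (cong₂ _,_ (CA-direction ax (proj₁ C) e₃x (x * ex) _ (cong proj₁ (Edge.endpoint E₃)) (cong proj₁ C≡))
                 (CA-direction ay (proj₂ C) e₃y (x * ey) _ (cong proj₂ (Edge.endpoint E₃)) (cong proj₂ C≡)))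
      (Edge.isPrimitive E₃)))
    primitive-BC : Primitive (x - + 3 , + n)
    primitive-BC = Primitive-combination {ex} {ey} {proj₁ f} {proj₂ f} (subst Primitive
      (cong₂ _,_ (BC-direction ax (proj₁ B) (proj₁ C) ex e₂x _ (cong proj₁ (Edge.endpoint E₁)) (cong proj₁ (Edge.endpoint E₂)) (cong proj₁ C≡))
                 (BC-direction ay (proj₂ B) (proj₂ C) ey e₂y _ (cong proj₂ (Edge.endpoint E₁)) (cong proj₂ (Edge.endpoint E₂)) (cong proj₂ C≡)))
      (Edge.isPrimitive E₂))
    B≡ : B ≡ (ax + + 3 * ex + 0ℤ * - (σ * v) , ay + + 3 * ey + 0ℤ * (σ * u))
    B≡ = trans (Edge.endpoint E₁) (cong₂ _,_ (eq ax ex (- (σ * v))) (eq ay ey (σ * u)))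
      where
      eq : ∀ a e f → a + + 3 * e ≡ a + + 3 * e + 0ℤ * f
      eq = solve-∀ ℤ-ring
    by-parity : ∃[ m ] (n ≡ m ℕ.+ m ⊎ n ≡ suc (m ℕ.+ m)) → ∃[ m ] HasExactly (m ℕ.* 3) (InteriorPoint T)
    by-parity (m , inj₁ n≡) = ⊥-elim (Primitive⇒¬even x m
      (subst (λ n → Primitive (x , + n)) n≡ primitive-AC) (subst (λ n → Primitive (x - + 3 , + n)) n≡ primitive-BC))
    by-parity (m , inj₂ n≡) = m , InFrame.interior-count T e f σ σσ≡1 det-ef x m
      B≡
      (subst (λ n → C ≡ (ax + x * ex + + n * - (σ * v) , ay + x * ey + + n * (σ * u))) n≡ C≡)
      (subst (λ n → Primitive (x , + n)) n≡ primitive-AC) (subst (λ n → Primitive (x - + 3 , + n)) n≡ primitive-BC)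

  -- The edge vectors sum to zero, so the third is `-2 (e₁ + e₂)`, whereas length 1 makes it
  -- primitive.
  Edge-2-2⇒¬1 : ∀ {P Q R e₁ e₂ e₃} → Edge P Q 2 e₁ → Edge Q R 2 e₂ → Edge R P 1 e₃ → ⊥
  Edge-2-2⇒¬1 {px , py} {e₁ = ax , ay} {bx , by} {cx , cy} record { endpoint = refl } record { endpoint = refl }
    record { isPrimitive = u , v , prim ; endpoint = endpoint } =
    2i≢1 (- (u * (ax + bx) + v * (ay + by))) (trans (eq u v ax ay bx by)
      (trans (cong₂ (λ x y → u * x + v * y) (sym (double px ax bx cx (cong proj₁ endpoint))) (sym (double py ay by cy (cong proj₂ endpoint)))) prim))
    where
    eq : ∀ u v ax ay bx by → + 2 * - (u * (ax + bx) + v * (ay + by)) ≡ u * - (+ 2 * (ax + bx)) + v * - (+ 2 * (ay + by))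
    eq = solve-∀ ℤ-ring
    double : ∀ p a b c → p ≡ p + + 2 * a + + 2 * b + 1ℤ * c → c ≡ - (+ 2 * (a + b))
    double p a b c p≡ = trans (split p a b c) (trans (cong (λ t → t - (p + + 2 * a + + 2 * b)) (sym p≡)) (eq′ p a b))
      where
      split : ∀ p a b c → c ≡ p + + 2 * a + + 2 * b + 1ℤ * c - (p + + 2 * a + + 2 * b)
      split = solve-∀ ℤ-ring
      eq′ : ∀ p a b → p - (p + + 2 * a + + 2 * b) ≡ - (+ 2 * (a + b))
      eq′ = solve-∀ ℤ-ring

  -- Two further rotations undo the first: three restore the vertices, and `InteriorPoint` depends
  -- on the vertices alone.
  InteriorPoint-rotate⇔ : ∀ T p → InteriorPoint (rotate T) p ⇔ InteriorPoint T p
  InteriorPoint-rotate⇔ T p = mk⇔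
    (λ i → InteriorPoint-rotate (rotate (rotate T)) {p} (InteriorPoint-rotate (rotate T) {p} i))
    (InteriorPoint-rotate T {p})

  B5⇒interior-multiple-of-3 : ∀ T → HasExactly 5 (BoundaryPoint T) → ∃[ m ] HasExactly (m ℕ.* 3) (InteriorPoint T)
  B5⇒interior-multiple-of-3 T five = cases g₁ g₂ g₃ E₁ E₂ E₃ (HasExactly-unique (BoundaryPoint-count T E₁ E₂ E₃) five)
    where
    open LatticeTriangle T
    A≢B : A ≢ B
    A≢B eq = area≢0 T (trans (cong (λ P → orient P B C) eq) (trans (orient-rotate B B C) (orient-PQP≡0 B C)))
    B≢C : B ≢ C
    B≢C eq = area≢0 T (trans (cong (orient A B) (sym eq)) (orient-PQQ≡0 A B))
    C≢A : C ≢ A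
    C≢A eq = area≢0 T (trans (cong (orient A B) eq) (orient-PQP≡0 A B))
    g₁ = proj₁ (edge A B A≢B) ; E₁ = proj₂ (proj₂ (edge A B A≢B))
    g₂ = proj₁ (edge B C B≢C) ; E₂ = proj₂ (proj₂ (edge B C B≢C))
    g₃ = proj₁ (edge C A C≢A) ; E₃ = proj₂ (proj₂ (edge C A C≢A))
    Goal = ∃[ m ] HasExactly (m ℕ.* 3) (InteriorPoint T)
    unrotate : ∃[ m ] HasExactly (m ℕ.* 3) (InteriorPoint (rotate T)) → Goal
    unrotate (m , count) = m , HasExactly-cong (InteriorPoint-rotate⇔ T) count
    unrotate² : ∃[ m ] HasExactly (m ℕ.* 3) (InteriorPoint (rotate (rotate T))) → Goal
    unrotate² (m , count) = unrotate (m , HasExactly-cong (InteriorPoint-rotate⇔ (rotate T)) count)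
    cases : ∀ g₁ g₂ g₃ {e₁ e₂ e₃} → Edge A B g₁ e₁ → Edge B C g₂ e₂ → Edge C A g₃ e₃ → g₁ ℕ.+ (g₂ ℕ.+ g₃) ≡ 5 → Goal
    cases 0 _ _ record { length>0 = () } _ _ _
    cases _ 0 _ _ record { length>0 = () } _ _
    cases _ _ 0 _ _ record { length>0 = () } _
    cases 1 1 3 E₁ E₂ E₃ refl = unrotate² (interior-multiple-of-3 (rotate (rotate T)) E₃ E₁ E₂)
    cases 1 2 2 E₁ E₂ E₃ refl = ⊥-elim (Edge-2-2⇒¬1 E₂ E₃ E₁)
    cases 1 3 1 E₁ E₂ E₃ refl = unrotate (interior-multiple-of-3 (rotate T) E₂ E₃ E₁)
    cases 2 1 2 E₁ E₂ E₃ refl = ⊥-elim (Edge-2-2⇒¬1 E₃ E₁ E₂)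
    cases 2 2 1 E₁ E₂ E₃ refl = ⊥-elim (Edge-2-2⇒¬1 E₁ E₂ E₃)
    cases 3 1 1 E₁ E₂ E₃ refl = interior-multiple-of-3 T E₁ E₂ E₃
    -- The remaining lengths add up to at least 6; subtracting 5 leaves a sum with a successor as
    -- summand that should be 0.
    cases 1 (suc (suc (suc (suc g₂)))) (suc g₃) _ _ _ eq = ⊥-elim (ℕ.m+1+n≢0 g₂ (cong (ℕ._∸ 5) eq))
    cases 2 (suc (suc (suc g₂))) (suc g₃) _ _ _ eq = ⊥-elim (ℕ.m+1+n≢0 g₂ (cong (ℕ._∸ 5) eq))
    cases 3 (suc (suc g₂)) (suc g₃) _ _ _ eq = ⊥-elim (ℕ.m+1+n≢0 g₂ (cong (ℕ._∸ 5) eq))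
    cases (suc (suc (suc (suc g₁)))) (suc g₂) (suc g₃) _ _ _ eq =
      ⊥-elim (ℕ.m+1+n≢0 (g₁ ℕ.+ g₂) (trans (ℕ.+-assoc g₁ g₂ (suc g₃))
        (cong (ℕ._∸ 5) (trans (cong (4 ℕ.+_) (sym (ℕ.+-suc g₁ (g₂ ℕ.+ suc g₃)))) eq))))

  -- A family of triangles with non-collinear interior points

  module Example (m : ℕ) where
    H : ℤ
    H = + suc (m ℕ.+ m)

    -- The abscissa 1 is prime to every height, and 1 - 3 = -2 is prime to every odd one, so this
    -- choice works for all `m`.
    O₀ I₀ J₀ : Lattice
    O₀ = 0ℤ , 0ℤ
    I₀ = + 3 , 0ℤ
    J₀ = 1ℤ , H

    T : LatticeTriangle
    T = record
      { A = O₀ ; B = I₀ ; C = J₀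
      ; nondegenerate = orient≢0⇒¬Collinear {_∈ O₀ ∷ I₀ ∷ J₀ ∷ []} {O₀} {I₀} {J₀} (here refl) (there (here refl)) (there (there (here refl)))
          λ ()
      }

    primitive-BC : Primitive (1ℤ - + 3 , H)
    primitive-BC = + m , 1ℤ , eq (+ m)
      where
      eq : ∀ m → m * - (+ 2) + 1ℤ * (1ℤ + (m + m)) ≡ 1ℤ
      eq = solve-∀ ℤ-ring

    five : HasExactly 5 (BoundaryPoint T)
    five = BoundaryPoint-count T edge-AB edge-BC edge-CA
      where
      eq : ∀ h → h ≡ 0ℤ + 1ℤ * h
      eq = solve-∀ ℤ-ring
      eq′ : ∀ h → 0ℤ ≡ h + 1ℤ * - h
      eq′ = solve-∀ ℤ-ring
      edge-AB : Edge O₀ I₀ 3 (1ℤ , 0ℤ)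
      edge-AB = record { length>0 = s≤s z≤n ; isPrimitive = 1ℤ , 0ℤ , refl ; endpoint = refl }
      edge-BC : Edge I₀ J₀ 1 (1ℤ - + 3 , H)
      edge-BC = record { length>0 = s≤s z≤n ; isPrimitive = primitive-BC ; endpoint = cong (1ℤ ,_) (eq H) }
      edge-CA : Edge J₀ O₀ 1 (- 1ℤ , - H)
      edge-CA = record { length>0 = s≤s z≤n ; isPrimitive = - 1ℤ , 0ℤ , refl ; endpoint = cong (0ℤ ,_) (eq′ H) }

    open InFrame T (1ℤ , 0ℤ) (0ℤ , 1ℤ) 1ℤ refl refl 1ℤ m
    open Rows 1ℤ m using (InTriangle)
    open Frame O₀ (1ℤ , 0ℤ) (0ℤ , 1ℤ) 1ℤ refl refl using (φ)

    C≡ : J₀ ≡ (0ℤ + 1ℤ * 1ℤ + H * 0ℤ , 0ℤ + 1ℤ * 0ℤ + H * 1ℤ)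
    C≡ = cong₂ _,_ (eq H) (eq′ H)
      where
      eq : ∀ h → 1ℤ ≡ 1ℤ + h * 0ℤ
      eq = solve-∀ ℤ-ring
      eq′ : ∀ h → h ≡ 0ℤ + h * 1ℤ
      eq′ = solve-∀ ℤ-ring

    count : HasExactly (m ℕ.* 3) (InteriorPoint T)
    count = interior-count refl C≡ (1ℤ , 0ℤ , refl) primitive-BC

    interior : ∀ z → InTriangle z → InteriorPoint T (φ z)
    interior z = Equivalence.from (interior⇔ refl C≡ z)

    -- At (1 , 1), (2 , 1), (1 , 2) the values of `offset` and `below` are 2m and 4m, 4m + 1 and 2m
    -- - 1, 2m - 1 and 4m - 2; all are positive because m ≥ 1.
    noncollinear : 0 ℕ.< m → ¬ Collinear (InteriorPoint T)
    noncollinear 0<m = orient≢0⇒¬Collinear {InteriorPoint T} {1ℤ , 1ℤ} {+ 2 , 1ℤ} {1ℤ , + 2}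
      (interior (1ℤ , 1ℤ) (0<1 , subst (0ℤ <_) (o₁ M) 0<2M , subst (0ℤ <_) (b₁ M) 0<4M))
      (interior (+ 2 , 1ℤ) (0<1 , subst (0ℤ <_) (o₂ M) (0<i+j 0<4M 0<1) , subst (0ℤ <_) (b₂ M) 0<2M-1))
      (interior (1ℤ , + 2) (+<+ (s≤s z≤n) , subst (0ℤ <_) (o₃ M) 0<2M-1 , subst (0ℤ <_) (b₃ M) (0<i+j 0<2M-1 0<2M-1)))
      λ ()
      where
      M = + m
      0<1 : 0ℤ < 1ℤ
      0<1 = +<+ (s≤s z≤n)
      0<M : 0ℤ < M
      0<M = +<+ 0<m
      0<2M : 0ℤ < M + M
      0<2M = 0<i+j 0<M 0<M
      0<4M : 0ℤ < M + M + (M + M)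
      0<4M = 0<i+j 0<2M 0<2M
      o₁ : ∀ M → M + M ≡ 1ℤ * (1ℤ + (M + M)) - 1ℤ * 1ℤ
      o₁ = solve-∀ ℤ-ring
      b₁ : ∀ M → M + M + (M + M) ≡ + 3 * (1ℤ + (M + M)) - (1ℤ * (1ℤ + (M + M)) - 1ℤ * 1ℤ) - + 3 * 1ℤ
      b₁ = solve-∀ ℤ-ring
      o₂ : ∀ M → M + M + (M + M) + 1ℤ ≡ + 2 * (1ℤ + (M + M)) - 1ℤ * 1ℤ
      o₂ = solve-∀ ℤ-ring
      b₂ : ∀ M → M + (M - 1ℤ) ≡ + 3 * (1ℤ + (M + M)) - (+ 2 * (1ℤ + (M + M)) - 1ℤ * 1ℤ) - + 3 * 1ℤ
      b₂ = solve-∀ ℤ-ring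
      0<2M-1 : 0ℤ < M + (M - 1ℤ)
      0<2M-1 = ℤ.+-mono-<-≤ 0<M (ℤ.i≤j⇒0≤j-i (+≤+ 0<m))
      o₃ : ∀ M → M + (M - 1ℤ) ≡ 1ℤ * (1ℤ + (M + M)) - 1ℤ * + 2
      o₃ = solve-∀ ℤ-ring
      b₃ : ∀ M → M + (M - 1ℤ) + (M + (M - 1ℤ)) ≡ + 3 * (1ℤ + (M + M)) - (1ℤ * (1ℤ + (M + M)) - 1ℤ * + 2) - + 3 * + 2
      b₃ = solve-∀ ℤ-ring

open import Data.Nat using (_<_)

theorem2 : (k : ℕ) → 0 < k → ¬ BCollinear 5 k
theorem2 k 0<k ((T , five , interior) , collinear) = Example.noncollinear m 0<m
  (collinear (Example.T m) (Example.five m , subst (λ n → HasExactly n (InteriorPoint (Example.T m))) m*3≡k (Example.count m)))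
  where
  divisible : ∃[ m ] HasExactly (m ℕ.* 3) (InteriorPoint T)
  divisible = B5⇒interior-multiple-of-3 T five
  m = proj₁ divisible
  m*3≡k : m ℕ.* 3 ≡ k
  m*3≡k = HasExactly-unique {S = InteriorPoint T} (proj₂ divisible) interior
  -- Positivity of `k` enters here: m = 0 would give k = 0.
  0<m : 0 < m
  0<m = ℕ.n≢0⇒n>0 λ m≡0 → ℕ.<⇒≢ 0<k (trans (cong (ℕ._* 3) (sym m≡0)) m*3≡k)
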